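{- If an RCRS is $c$-selectable on all bipartite graphs (with all fractional matchings), then $c\le 1/2$. That is, no RCRS is better than $1/2$-selectable on bipartite graphs.
   Context: For a finite graph $G=(V,E)$, a fractional matching is $\bm{x}\in[0,1]^E$ with $\sum_{e\ni v}x_e\le1$ for every vertex $v$. Each edge $e$ is active independently with probability $x_e$. A random-order contention resolution scheme (RCRS) is given $G$ and $\bm{x}$; the edges are presented to it one at a time in a uniformly random order; upon the arrival of $e$ it learns whether $e$ is active and must irrevocably decide (possibly using randomness) whether to select $e$; only active edges may be selected and the selected edges must form a matching. An RCRS is $c$-selectable on a class of inputs if on each input of the class every edge $e$ is selected with probability at least $cx_e$.
   Formalization: The constant c, the fractional matching x, and the probabilities with which the RCRS decides to select an arriving active edge are taken to be rational numbers instead of real numbers. -}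

module Defs where

open import Data.Nat using (ℕ)
open import Data.Fin using (Fin) renaming (_≟_ to _≟ᶠ_)
open import Data.Bool using (Bool; true; false; if_then_else_; _∧_; _∨_; not)
open import Data.Product using (_×_; _,_; proj₁; proj₂)
open import Data.List using (List; []; _∷_; _++_; [_]; map; filter; foldr; allFin; concatMap; length)
open import Data.Bool.ListAction using (any)
open import Data.Integer using (+_)
open import Data.Rational using (ℚ; 0ℚ; 1ℚ; _+_; _*_; _-_; _≤_; _/_)
open import Relation.Nullary.Decidable using (⌊_⌋)
open import Relation.Binary.PropositionalEquality using (_≡_)

sumℚ : List ℚ → ℚ
sumℚ = foldr _+_ 0ℚ

insertAll : {A : Set} → A → List A → List (List A)
insertAll a []       = (a ∷ []) ∷ []
insertAll a (b ∷ bs) = (a ∷ b ∷ bs) ∷ map (b ∷_) (insertAll a bs)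

perms : {A : Set} → List A → List (List A)
perms []       = [] ∷ []
perms (a ∷ as) = concatMap (insertAll a) (perms as)

-- Bipartite graphs with a fractional matching.
-- Vertex set = Fin a (left side) ⊎ Fin b (right side); edge set = Fin m,
-- edge e joins left vertex proj₁ (ends e) to right vertex proj₂ (ends e).
-- The graph is simple: distinct edges have distinct endpoint pairs.

record Instance : Set where
  field
    a b m  : ℕ
    ends   : Fin m → Fin a × Fin b
    simple : ∀ e f → ends e ≡ ends f → e ≡ f
    x      : Fin m → ℚ
    x≥0    : ∀ e → 0ℚ ≤ x e
    x≤1    : ∀ e → x e ≤ 1ℚ
    leftLoad  : ∀ (u : Fin a) →
      sumℚ (map x (filter (λ e → proj₁ (ends e) ≟ᶠ u) (allFin m))) ≤ 1ℚ
    rightLoad : ∀ (v : Fin b) →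
      sumℚ (map x (filter (λ e → proj₂ (ends e) ≟ᶠ v) (allFin m))) ≤ 1ℚ

-- Histories: the edges seen so far, in arrival order, each with whether it
-- was active and whether the scheme selected it.

History : ℕ → Set
History m = List (Fin m × Bool × Bool)

-- An RCRS, in behavioural form: for each input (G, x), each history and
-- each newly arrived *active* edge, the probability (a rational in [0,1])
-- of selecting that edge.
record RCRS : Set where
  field
    prob    : (I : Instance) → History (Instance.m I) → Fin (Instance.m I) → ℚ
    prob≥0  : ∀ I h e → 0ℚ ≤ prob I h e
    prob≤1  : ∀ I h e → prob I h e ≤ 1ℚ

module _ (R : RCRS) (I : Instance) where
  open Instance I
  open RCRS R

  adjacent : Fin m → Fin m → Bool
  adjacent e f = ⌊ proj₁ (ends e) ≟ᶠ proj₁ (ends f) ⌋ ∨ ⌊ proj₂ (ends e) ≟ᶠ proj₂ (ends f) ⌋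

  feasible : History m → Fin m → Bool
  feasible h f = not (any (λ { (g , act , sel) → sel ∧ adjacent g f }) h)

  selectedIn : Fin m → History m → Bool
  selectedIn e h = any (λ { (g , act , sel) → sel ∧ ⌊ g ≟ᶠ e ⌋ }) h

  -- effective selection probability: only active, feasible edges can be
  -- selected (an RCRS must output a matching of active edges)
  effProb : History m → Fin m → ℚ
  effProb h f = if feasible h f then prob I h f else 0ℚ

  -- probability that e ends up selected, given the history so far and the
  -- remaining arrival order (activity of each edge independent, Pr = x f)
  go : Fin m → History m → List (Fin m) → ℚ
  go e h []       = if selectedIn e h then 1ℚ else 0ℚ
  go e h (f ∷ fs) =
      x f * (effProb h f * go e (h ++ [ (f , true , true) ]) fs
             + (1ℚ - effProb h f) * go e (h ++ [ (f , true , false) ]) fs)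
    + (1ℚ - x f) * go e (h ++ [ (f , false , false) ]) fs

  orders : List (List (Fin m))
  orders = perms (allFin m)

  -- Pr[e selected] * (number of orders), the order being uniformly random
  selTotal : Fin m → ℚ
  selTotal e = sumℚ (map (go e []) orders)

  edgeSelectable : ℚ → Fin m → Set
  edgeSelectable c e = c * x e * (+ length orders / 1) ≤ selTotal e

SelectableOnBipartite : RCRS → ℚ → Set
SelectableOnBipartite R c = ∀ (I : Instance) (e : Fin (Instance.m I)) → edgeSelectable R I c e

{-# OPTIONS --safe #-}

-- On the complete bipartite graph K(n,n) with x = 1/n, let s be the number of unmatched vertices
-- on each side. An edge arriving active is uniform among the r remaining edges, and if these are
-- spread evenly it joins two unmatched vertices with probability s²/n². So 1/s grows by at most
-- about 1/n³ per arrival, hence from 1/n to at most about 2/n over all n² arrivals, and by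
-- convexity s is at least about n/2 on average at the end: no scheme selects more than about n/2
-- edges, whereas c-selectability demands c n. (In the proof 1/s is replaced by 1/(s+K), K = o(n).)
--
-- The scheme may adapt the set of unmatched vertices to the remaining edges, so evenness is needed
-- for all pairs of vertex sets at once. By Cauchy–Schwarz it follows from a bound on the sum Q of
-- the products, over all closed 4-walks, of the centred indicators ξ of "edge still remains". Such
-- a product over a genuine 4-cycle is, up to a small error, an eigenfunction of the removal of a
-- random edge, so the expected sum of Q over the whole process has an explicit supersolution Pot.

module Submission where

open import Defs
open import Data.Bool using (Bool; true; false; if_then_else_; _∧_; _∨_; not)
open import Data.Bool.ListAction using (any)
open import Data.Bool.Properties using (∨-identityʳ; ∨-assoc)
open import Data.Empty using (⊥-elim)
open import Data.Fin using (Fin; zero; suc; combine; remQuot; _↑ˡ_; _↑ʳ_) renaming (_≟_ to _≟ᶠ_)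
import Data.Fin.Properties as Finₚ
import Data.Integer as ℤ
import Data.Integer.Properties as ℤₚ
open import Data.List using (List; []; _∷_; _++_; [_]; map; filter; concatMap; length; allFin; cartesianProduct)
open import Data.List.Properties using (map-tabulate; length-tabulate)
open import Data.List.Relation.Unary.All using (All; []; _∷_) renaming (map to All-map)
open import Data.List.Relation.Unary.All.Properties using () renaming (map⁺ to All-map⁺)
open import Data.Nat using (ℕ; zero; suc; z≤n; s≤s)
  renaming (_+_ to _+ᴺ_; _*_ to _*ᴺ_; _≤_ to _≤ᴺ_; _⊓_ to _⊓ᴺ_; _! to _!ᴺ)
import Data.Nat as ℕ
import Data.Nat.Properties as ℕₚ
open import Data.Product using (∃; _×_; _,_; proj₁; proj₂)
open import Data.Rational
  using (ℚ; mkℚ; 0ℚ; 1ℚ; ½; _+_; _*_; -_; _-_; _/_; 1/_; ↧ₙ_; _≤_; _<_; *≡*; ∣_∣; _≤?_; _<?_; toℚᵘ;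
         positive; nonNegative)
open import Data.Rational.Properties
open import Algebra.Properties.Group +-0-group using () renaming (∙-cancelˡ to +-cancelˡ)
import Data.Rational.Unnormalised as ℚᵘ
import Data.Rational.Unnormalised.Properties as ℚᵘₚ
open import Data.Sum using (inj₁; inj₂)
open import Function using (_∘_; id)
open import Level using (0ℓ)
open import Relation.Binary.PropositionalEquality hiding ([_])
open import Relation.Nullary using (¬_; yes; no)
open import Relation.Nullary.Decidable using (⌊_⌋; dec⇒maybe; toWitness)
open import Tactic.RingSolver using (solve-∀)
open import Tactic.RingSolver.Core.AlmostCommutativeRing using (AlmostCommutativeRing; fromCommutativeRing)

-- Ordered arithmetic in ℚ.

ℚ-ring : AlmostCommutativeRing 0ℓ 0ℓ
ℚ-ring = fromCommutativeRing +-*-commutativeRing (λ x → dec⇒maybe (0ℚ ≟ x))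

0≤-+ : ∀ {p q} → 0ℚ ≤ p → 0ℚ ≤ q → 0ℚ ≤ p + q
0≤-+ = +-mono-≤

*-monoˡ : ∀ {r p q} → 0ℚ ≤ r → p ≤ q → r * p ≤ r * q
*-monoˡ {r} 0≤r = *-monoˡ-≤-nonNeg r {{nonNegative 0≤r}}

*-monoʳ : ∀ {r p q} → 0ℚ ≤ r → p ≤ q → p * r ≤ q * r
*-monoʳ {r} 0≤r = *-monoʳ-≤-nonNeg r {{nonNegative 0≤r}}

*-mono : ∀ {p q r s} → 0ℚ ≤ r → 0ℚ ≤ q → p ≤ q → r ≤ s → p * r ≤ q * s
*-mono 0≤r 0≤q p≤q r≤s = ≤-trans (*-monoʳ 0≤r p≤q) (*-monoˡ 0≤q r≤s)

0≤-* : ∀ {p q} → 0ℚ ≤ p → 0ℚ ≤ q → 0ℚ ≤ p * q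
0≤-* {p} {q} 0≤p 0≤q = ≤-trans (≤-reflexive (sym (*-zeroʳ p))) (*-monoˡ 0≤p 0≤q)

≤⇒0≤- : ∀ {p q} → p ≤ q → 0ℚ ≤ q - p
≤⇒0≤- {p} {q} p≤q = ≤-trans (≤-reflexive (sym (+-inverseʳ p))) (+-monoˡ-≤ (- p) p≤q)

≤-gap : ∀ {p q} d → 0ℚ ≤ d → p + d ≡ q → p ≤ q
≤-gap {p} d 0≤d refl = ≤-trans (≤-reflexive (sym (+-identityʳ p))) (+-monoʳ-≤ p 0≤d)

0≤x² : ∀ x → 0ℚ ≤ x * x
0≤x² x with ≤-total 0ℚ x
... | inj₁ 0≤x = 0≤-* 0≤x 0≤x
... | inj₂ x≤0 = ≤-trans (0≤-* 0≤-x 0≤-x) (≤-reflexive (neg² x))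
  where
  0≤-x : 0ℚ ≤ - x
  0≤-x = neg-antimono-≤ x≤0
  neg² : ∀ x → - x * - x ≡ x * x
  neg² = solve-∀ ℚ-ring

-- Natural numbers in ℚ, reciprocals and the Archimedean property.

-- Defined by recursion and not by `_/_`, so that the length of a list with one more entry becomes
-- `1ℚ + ρ` by computation.
ι : ℕ → ℚ
ι zero    = 0ℚ
ι (suc k) = 1ℚ + ι k

0≤ι : ∀ k → 0ℚ ≤ ι k
0≤ι zero    = ≤-refl
0≤ι (suc k) = 0≤-+ (toWitness {a? = 0ℚ ≤? 1ℚ} _) (0≤ι k)

0<ι : ∀ k → .{{ℕ.NonZero k}} → 0ℚ < ι k
0<ι (suc k) = <-≤-trans (toWitness {a? = 0ℚ <? 1ℚ} _) (≤-gap (ι k) (0≤ι k) refl)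

ι-+ : ∀ j k → ι (j +ᴺ k) ≡ ι j + ι k
ι-+ zero    k = sym (+-identityˡ (ι k))
ι-+ (suc j) k = trans (cong (1ℚ +_) (ι-+ j k)) (sym (+-assoc 1ℚ (ι j) (ι k)))

ι-* : ∀ j k → ι (j *ᴺ k) ≡ ι j * ι k
ι-* zero    k = sym (*-zeroˡ (ι k))
ι-* (suc j) k = trans (ι-+ k (j *ᴺ k)) (trans (cong (ι k +_) (ι-* j k)) (step (ι j) (ι k)))
  where
  step : ∀ x y → y + x * y ≡ (1ℚ + x) * y
  step = solve-∀ ℚ-ring

ι-mono : ∀ {j k} → j ≤ᴺ k → ι j ≤ ι k
ι-mono {k = k} z≤n = 0≤ι k
ι-mono (s≤s j≤k)   = +-monoʳ-≤ 1ℚ (ι-mono j≤k)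

-- Junk value at zero: recip 0 = 0.
recip : ℕ → ℚ
recip zero    = 0ℚ
recip (suc k) = (1/ ι (suc k)) {{pos⇒nonZero (ι (suc k)) {{positive (0<ι (suc k))}}}}

ι*recip : ∀ k → .{{ℕ.NonZero k}} → ι k * recip k ≡ 1ℚ
ι*recip (suc k) = *-inverseʳ (ι (suc k)) {{pos⇒nonZero (ι (suc k)) {{positive (0<ι (suc k))}}}}

0≤recip : ∀ k → 0ℚ ≤ recip k
0≤recip zero    = ≤-refl
0≤recip (suc k) = <⇒≤ (positive⁻¹ (recip (suc k)) {{1/pos⇒pos (ι (suc k)) {{positive (0<ι (suc k))}}}})

≤recip : ∀ k {p} → .{{ℕ.NonZero k}} → ι k * p ≤ 1ℚ → p ≤ recip k
≤recip k {p} kp≤1 =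
  *-cancelˡ-≤-pos (ι k) {{positive (0<ι k)}} (≤-trans kp≤1 (≤-reflexive (sym (ι*recip k))))

recip-antimono : ∀ {j k} → .{{ℕ.NonZero j}} → j ≤ᴺ k → recip k ≤ recip j
recip-antimono {suc j} {suc k} j≤k =
  ≤recip (suc j) (≤-trans (*-monoʳ (0≤recip (suc k)) (ι-mono j≤k)) (≤-reflexive (ι*recip (suc k))))

-- Translates the `_/_` in the definition of selectability, and the denominators of rationals, into
-- `ι`.
+k/1≡ιk : ∀ k → (ℤ.+ k) / 1 ≡ ι k
+k/1≡ιk zero    = refl
+k/1≡ιk (suc k) = trans suc/1 (cong (1ℚ +_) (+k/1≡ιk k))
  where
  open ℚᵘₚ.≃-Reasoning
  suc/1 : (ℤ.+ suc k) / 1 ≡ 1ℚ + (ℤ.+ k) / 1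
  suc/1 = toℚᵘ-injective (begin
    toℚᵘ ((ℤ.+ suc k) / 1)               ≈⟨ toℚᵘ-fromℚᵘ (ℚᵘ.mkℚᵘ (ℤ.+ suc k) 0) ⟩
    ℚᵘ.mkℚᵘ (ℤ.+ suc k) 0                ≈⟨ ℚᵘ.*≡* (cong (λ z → (ℤ.+ 1 ℤ.+ z) ℤ.* ℤ.+ 1) (sym (ℤₚ.*-identityʳ (ℤ.+ k)))) ⟩
    ℚᵘ.1ℚᵘ ℚᵘ.+ ℚᵘ.mkℚᵘ (ℤ.+ k) 0        ≈⟨ ℚᵘₚ.+-congʳ ℚᵘ.1ℚᵘ (ℚᵘₚ.≃-sym (toℚᵘ-fromℚᵘ (ℚᵘ.mkℚᵘ (ℤ.+ k) 0))) ⟩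
    ℚᵘ.1ℚᵘ ℚᵘ.+ toℚᵘ ((ℤ.+ k) / 1)       ≈⟨ ℚᵘₚ.≃-sym (toℚᵘ-homo-+ 1ℚ ((ℤ.+ k) / 1)) ⟩
    toℚᵘ (1ℚ + (ℤ.+ k) / 1)              ∎)

-- Multiplication by the denominator leaves the numerator, a positive integer. This is the
-- Archimedean property behind the final contradiction.
1≤denominator* : ∀ p → 0ℚ < p → 1ℚ ≤ ι (↧ₙ p) * p
1≤denominator* (mkℚ (ℤ.+ zero) d c)   0<p = ⊥-elim (<⇒≢ 0<p (sym (≃⇒≡ {mkℚ (ℤ.+ zero) d c} (*≡* refl))))
1≤denominator* (mkℚ ℤ.-[1+ k ] d c)   0<p = ⊥-elim (<-asym 0<p (negative⁻¹ (mkℚ ℤ.-[1+ k ] d c)))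
1≤denominator* p@(mkℚ ℤ.+[1+ k ] d c) 0<p = toℚᵘ-cancel-≤ (begin
  ℚᵘ.1ℚᵘ                              ≤⟨ ℚᵘ.*≤* (ℤ.+≤+ (ℕₚ.≤-trans (ℕₚ.≤-reflexive (trans (ℕₚ.*-identityˡ _) (ℕₚ.*-identityˡ _))) (ℕₚ.≤-trans (ℕₚ.m≤m*n (suc d) (suc k)) (ℕₚ.≤-reflexive (sym (ℕₚ.*-identityʳ _)))))) ⟩
  ℚᵘ.mkℚᵘ (ℤ.+ suc d) 0 ℚᵘ.* toℚᵘ p   ≃⟨ ℚᵘₚ.*-congʳ {toℚᵘ p} (ℚᵘₚ.≃-sym (toℚᵘ-fromℚᵘ (ℚᵘ.mkℚᵘ (ℤ.+ suc d) 0))) ⟩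
  toℚᵘ ((ℤ.+ suc d) / 1) ℚᵘ.* toℚᵘ p  ≃⟨ ℚᵘₚ.≃-sym (toℚᵘ-homo-* ((ℤ.+ suc d) / 1) p) ⟩
  toℚᵘ ((ℤ.+ suc d) / 1 * p)          ≡⟨ cong (λ x → toℚᵘ (x * p)) (+k/1≡ιk (suc d)) ⟩
  toℚᵘ (ι (suc d) * p)                ∎)
  where open ℚᵘₚ.≤-Reasoning

-- Finite sums over lists, products and `Fin`.

module _ {A : Set} where

  ∑ : List A → (A → ℚ) → ℚ
  ∑ xs f = sumℚ (map f xs)

  ∑-cong : ∀ xs {f g : A → ℚ} → (∀ x → f x ≡ g x) → ∑ xs f ≡ ∑ xs g
  ∑-cong []       f≡g = refl
  ∑-cong (x ∷ xs) f≡g = cong₂ _+_ (f≡g x) (∑-cong xs f≡g)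

  ∑-cong-All : ∀ {xs} {f g : A → ℚ} → All (λ x → f x ≡ g x) xs → ∑ xs f ≡ ∑ xs g
  ∑-cong-All []            = refl
  ∑-cong-All (f≡g ∷ fs≡gs) = cong₂ _+_ f≡g (∑-cong-All fs≡gs)

  ∑-mono-All : ∀ {xs} {f g : A → ℚ} → All (λ x → f x ≤ g x) xs → ∑ xs f ≤ ∑ xs g
  ∑-mono-All []           = ≤-refl
  ∑-mono-All (f≤g ∷ fs≤gs) = +-mono-≤ f≤g (∑-mono-All fs≤gs)

  ∑-mono : ∀ xs {f g : A → ℚ} → (∀ x → f x ≤ g x) → ∑ xs f ≤ ∑ xs g
  ∑-mono []       f≤g = ≤-refl
  ∑-mono (x ∷ xs) f≤g = +-mono-≤ (f≤g x) (∑-mono xs f≤g)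

  ∑-+ : ∀ xs (f g : A → ℚ) → ∑ xs (λ x → f x + g x) ≡ ∑ xs f + ∑ xs g
  ∑-+ []       f g = refl
  ∑-+ (x ∷ xs) f g = trans (cong (f x + g x +_) (∑-+ xs f g)) (interchange (f x) (g x) (∑ xs f) (∑ xs g))
    where
    interchange : ∀ a b c d → a + b + (c + d) ≡ a + c + (b + d)
    interchange = solve-∀ ℚ-ring

  ∑-*ˡ : ∀ xs c (f : A → ℚ) → ∑ xs (λ x → c * f x) ≡ c * ∑ xs f
  ∑-*ˡ []       c f = sym (*-zeroʳ c)
  ∑-*ˡ (x ∷ xs) c f = trans (cong (c * f x +_) (∑-*ˡ xs c f)) (sym (*-distribˡ-+ c (f x) (∑ xs f)))

  ∑-const : ∀ (xs : List A) c → ∑ xs (λ _ → c) ≡ ι (length xs) * c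
  ∑-const []       c = sym (*-zeroˡ c)
  ∑-const (x ∷ xs) c = trans (cong (_+_ c) (∑-const xs c)) (distrib (ι (length xs)) c)
    where
    distrib : ∀ l c → c + l * c ≡ (1ℚ + l) * c
    distrib = solve-∀ ℚ-ring

  0≤∑ : ∀ xs {f : A → ℚ} → (∀ x → 0ℚ ≤ f x) → 0ℚ ≤ ∑ xs f
  0≤∑ xs 0≤f = ≤-trans (≤-reflexive (sym (trans (∑-const xs 0ℚ) (*-zeroʳ (ι (length xs)))))) (∑-mono xs 0≤f)

  ∑-++ : ∀ xs ys (f : A → ℚ) → ∑ (xs ++ ys) f ≡ ∑ xs f + ∑ ys f
  ∑-++ []       ys f = sym (+-identityˡ _)
  ∑-++ (x ∷ xs) ys f = trans (cong (f x +_) (∑-++ xs ys f)) (sym (+-assoc (f x) (∑ xs f) (∑ ys f)))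

∑-map : ∀ {A B : Set} (h : A → B) xs (f : B → ℚ) → ∑ (map h xs) f ≡ ∑ xs (f ∘ h)
∑-map h []       f = refl
∑-map h (x ∷ xs) f = cong (f (h x) +_) (∑-map h xs f)

∑-comm : ∀ {A B : Set} xs ys (f : A → B → ℚ) → ∑ xs (λ x → ∑ ys (f x)) ≡ ∑ ys (λ y → ∑ xs (λ x → f x y))
∑-comm []       ys f = sym (trans (∑-const ys 0ℚ) (*-zeroʳ (ι (length ys))))
∑-comm (x ∷ xs) ys f =
  trans (cong (∑ ys (f x) +_) (∑-comm xs ys f)) (sym (∑-+ ys (f x) (λ y → ∑ xs (λ x → f x y))))

∑-concatMap : ∀ {A B : Set} (h : A → List B) xs (f : B → ℚ) → ∑ (concatMap h xs) f ≡ ∑ xs (λ x → ∑ (h x) f)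
∑-concatMap h []       f = refl
∑-concatMap h (x ∷ xs) f = trans (∑-++ (h x) (concatMap h xs) f) (cong (∑ (h x) f +_) (∑-concatMap h xs f))

∑-× : ∀ {A B : Set} xs ys (f : A × B → ℚ) →
      ∑ (cartesianProduct xs ys) f ≡ ∑ xs (λ x → ∑ ys (λ y → f (x , y)))
∑-× []       ys f = refl
∑-× (x ∷ xs) ys f = trans (∑-++ (map (x ,_) ys) (cartesianProduct xs ys) f)
  (cong₂ _+_ (∑-map (x ,_) ys f) (∑-× xs ys f))

∑-product : ∀ {A B : Set} xs ys (f : A → ℚ) (g : B → ℚ) →
            ∑ xs f * ∑ ys g ≡ ∑ xs (λ x → ∑ ys (λ y → f x * g y))
∑-product xs ys f g = begin
  ∑ xs f * ∑ ys g                     ≡⟨ *-comm (∑ xs f) (∑ ys g) ⟩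
  ∑ ys g * ∑ xs f                     ≡⟨ sym (∑-*ˡ xs (∑ ys g) f) ⟩
  ∑ xs (λ x → ∑ ys g * f x)           ≡⟨ ∑-cong xs (λ x → trans (*-comm (∑ ys g) (f x)) (sym (∑-*ˡ ys (f x) g))) ⟩
  ∑ xs (λ x → ∑ ys (λ y → f x * g y)) ∎
  where open ≡-Reasoning

∑-allFin-suc : ∀ {n} (f : Fin (suc n) → ℚ) → ∑ (allFin (suc n)) f ≡ f zero + ∑ (allFin n) (f ∘ suc)
∑-allFin-suc {n} f = cong (λ xs → f zero + sumℚ xs)
  (trans (map-tabulate suc f) (sym (map-tabulate id (f ∘ suc))))

∑-allFin-+ : ∀ j {k} (f : Fin (j +ᴺ k) → ℚ) →
             ∑ (allFin (j +ᴺ k)) f ≡ ∑ (allFin j) (f ∘ (_↑ˡ k)) + ∑ (allFin k) (f ∘ (j ↑ʳ_))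
∑-allFin-+ zero    f = sym (+-identityˡ _)
∑-allFin-+ (suc j) {k} f = begin
  ∑ (allFin (suc j +ᴺ k)) f
    ≡⟨ ∑-allFin-suc f ⟩
  f zero + ∑ (allFin (j +ᴺ k)) (f ∘ suc)
    ≡⟨ cong (f zero +_) (∑-allFin-+ j (f ∘ suc)) ⟩
  f zero + (∑ (allFin j) (f ∘ suc ∘ (_↑ˡ k)) + ∑ (allFin k) (f ∘ suc ∘ (j ↑ʳ_)))
    ≡⟨ sym (+-assoc (f zero) _ _) ⟩
  f zero + ∑ (allFin j) (f ∘ suc ∘ (_↑ˡ k)) + ∑ (allFin k) (f ∘ suc ∘ (j ↑ʳ_))
    ≡⟨ cong (_+ ∑ (allFin k) (f ∘ suc ∘ (j ↑ʳ_))) (sym (∑-allFin-suc (f ∘ (_↑ˡ k)))) ⟩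
  ∑ (allFin (suc j)) (f ∘ (_↑ˡ k)) + ∑ (allFin k) (f ∘ (suc j ↑ʳ_)) ∎
  where open ≡-Reasoning

∑-combine : ∀ j {k} (f : Fin (j *ᴺ k) → ℚ) →
            ∑ (allFin (j *ᴺ k)) f ≡ ∑ (allFin j) (λ u → ∑ (allFin k) (λ v → f (combine u v)))
∑-combine zero    f = refl
∑-combine (suc j) {k} f = begin
  ∑ (allFin (k +ᴺ j *ᴺ k)) f
    ≡⟨ ∑-allFin-+ k f ⟩
  ∑ (allFin k) (f ∘ (_↑ˡ j *ᴺ k)) + ∑ (allFin (j *ᴺ k)) (f ∘ (k ↑ʳ_))
    ≡⟨ cong (∑ (allFin k) (f ∘ (_↑ˡ j *ᴺ k)) +_) (∑-combine j (f ∘ (k ↑ʳ_))) ⟩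
  ∑ (allFin k) (f ∘ (_↑ˡ j *ᴺ k)) + ∑ (allFin j) (λ u → ∑ (allFin k) (λ v → f (combine (suc u) v)))
    ≡⟨ sym (∑-allFin-suc {j} (λ u → ∑ (allFin k) (λ v → f (combine {suc j} u v)))) ⟩
  ∑ (allFin (suc j)) (λ u → ∑ (allFin k) (λ v → f (combine u v))) ∎
  where open ≡-Reasoning

∑-remQuot : ∀ j k (f : Fin j × Fin k → ℚ) →
            ∑ (allFin (j *ᴺ k)) (f ∘ remQuot k) ≡ ∑ (allFin j) (λ u → ∑ (allFin k) (λ v → f (u , v)))
∑-remQuot j k f = trans (∑-combine j (f ∘ remQuot k))
  (∑-cong (allFin j) (λ u → ∑-cong (allFin k) (λ v → cong f (Finₚ.remQuot-combine u v))))

-- Indicators and Kronecker deltas.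

𝟙 : Bool → ℚ
𝟙 b = if b then 1ℚ else 0ℚ

0≤𝟙 : ∀ b → 0ℚ ≤ 𝟙 b
0≤𝟙 false = ≤-refl
0≤𝟙 true  = toWitness {a? = 0ℚ ≤? 1ℚ} _

𝟙≤1 : ∀ b → 𝟙 b ≤ 1ℚ
𝟙≤1 false = toWitness {a? = 0ℚ ≤? 1ℚ} _
𝟙≤1 true  = ≤-refl

δᶠ : ∀ {n} → Fin n → Fin n → ℚ
δᶠ i j = 𝟙 ⌊ i ≟ᶠ j ⌋

δᶠ-suc : ∀ {n} (i j : Fin n) → δᶠ (suc i) (suc j) ≡ δᶠ i j
δᶠ-suc i j with i ≟ᶠ j
... | yes _ = refl
... | no  _ = refl

δᶠ-sym : ∀ {n} (i j : Fin n) → δᶠ i j ≡ δᶠ j i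
δᶠ-sym i j with i ≟ᶠ j | j ≟ᶠ i
... | yes _   | yes _   = refl
... | no _    | no _    = refl
... | yes i≡j | no j≢i  = ⊥-elim (j≢i (sym i≡j))
... | no i≢j  | yes j≡i = ⊥-elim (i≢j (sym j≡i))

∑-δᶠ : ∀ {n} (i : Fin n) (f : Fin n → ℚ) → ∑ (allFin n) (λ j → δᶠ i j * f j) ≡ f i
∑-δᶠ {suc n} zero f = begin
  ∑ (allFin (suc n)) (λ j → δᶠ zero j * f j)
    ≡⟨ ∑-allFin-suc (λ j → δᶠ zero j * f j) ⟩
  1ℚ * f zero + ∑ (allFin n) (λ j → 0ℚ * f (suc j))
    ≡⟨ cong₂ _+_ (*-identityˡ (f zero)) (trans (∑-*ˡ (allFin n) 0ℚ (f ∘ suc)) (*-zeroˡ (∑ (allFin n) (f ∘ suc)))) ⟩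
  f zero + 0ℚ
    ≡⟨ +-identityʳ (f zero) ⟩
  f zero ∎
  where open ≡-Reasoning
∑-δᶠ {suc n} (suc i) f = begin
  ∑ (allFin (suc n)) (λ j → δᶠ (suc i) j * f j)
    ≡⟨ ∑-allFin-suc (λ j → δᶠ (suc i) j * f j) ⟩
  0ℚ * f zero + ∑ (allFin n) (λ j → δᶠ (suc i) (suc j) * f (suc j))
    ≡⟨ cong₂ _+_ (*-zeroˡ (f zero)) (∑-cong (allFin n) (λ j → cong (_* f (suc j)) (δᶠ-suc i j))) ⟩
  0ℚ + ∑ (allFin n) (λ j → δᶠ i j * f (suc j))
    ≡⟨ +-identityˡ _ ⟩
  ∑ (allFin n) (λ j → δᶠ i j * f (suc j))
    ≡⟨ ∑-δᶠ i (f ∘ suc) ⟩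
  f (suc i) ∎
  where open ≡-Reasoning

∑-δᶠ-1 : ∀ {n} (i : Fin n) → ∑ (allFin n) (δᶠ i) ≡ 1ℚ
∑-δᶠ-1 {n} i = trans (∑-cong (allFin n) (λ j → sym (*-identityʳ (δᶠ i j)))) (∑-δᶠ i (λ _ → 1ℚ))

∑-filter : ∀ {A : Set} {n} (k : A → Fin n) (i : Fin n) xs (f : A → ℚ) →
           ∑ (filter (λ a → k a ≟ᶠ i) xs) f ≡ ∑ xs (λ a → δᶠ (k a) i * f a)
∑-filter k i []       f = refl
∑-filter k i (a ∷ xs) f with k a ≟ᶠ i
... | yes _ = cong₂ _+_ (sym (*-identityˡ (f a))) (∑-filter k i xs f)
... | no  _ = trans (∑-filter k i xs f) (trans (sym (+-identityˡ _)) (cong (_+ _) (sym (*-zeroˡ (f a)))))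

-- The first arrival in a uniformly random order.

keep : {A : Set} → A → A × List A → A × List A
keep a (b , bs) = b , a ∷ bs

picks : {A : Set} → List A → List (A × List A)
picks []       = []
picks (a ∷ as) = (a , as) ∷ map (keep a) (picks as)

∑-picks : ∀ {A : Set} (as : List A) (f : A → ℚ) → ∑ (picks as) (λ p → f (proj₁ p)) ≡ ∑ as f
∑-picks []       f = refl
∑-picks (a ∷ as) f = cong (f a +_) (trans (∑-map (keep a) (picks as) (λ p → f (proj₁ p))) (∑-picks as f))

∑-picks-const : ∀ {A : Set} (as : List A) c → ∑ (picks as) (λ _ → c) ≡ ι (length as) * c
∑-picks-const as c = trans (∑-picks as (λ _ → c)) (∑-const as c)

-- The rest of a pick is described only by its length and by the sums of all functions over it.
-- Counts of remaining edges depend on nothing else, so no reasoning about membership is required.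
record IsPick {A : Set} (as : List A) (p : A × List A) : Set where
  constructor isPick
  field
    pick-length : suc (length (proj₂ p)) ≡ length as
    pick-∑      : ∀ (f : A → ℚ) → f (proj₁ p) + ∑ (proj₂ p) f ≡ ∑ as f

open IsPick

IsPick-keep : ∀ {A : Set} (a : A) {as p} → IsPick as p → IsPick (a ∷ as) (keep a p)
IsPick-keep a {p = b , bs} pick = isPick (cong suc (pick-length pick)) λ f →
  trans (swap (f b) (f a) (∑ bs f)) (cong (f a +_) (pick-∑ pick f))
  where
  swap : ∀ x y z → x + (y + z) ≡ y + (x + z)
  swap = solve-∀ ℚ-ring

picks-IsPick : ∀ {A : Set} (as : List A) → All (IsPick as) (picks as)
picks-IsPick []       = []
picks-IsPick (a ∷ as) = isPick refl (λ f → refl) ∷ All-map⁺ (All-map (IsPick-keep a) (picks-IsPick as))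

-- The first element of a uniformly random order is a uniformly random element.
∑-perms : ∀ {A : Set} (a : A) as (F : List A → ℚ) →
          ∑ (perms (a ∷ as)) F ≡ ∑ (picks (a ∷ as)) (λ p → ∑ (perms (proj₂ p)) (λ l → F (proj₁ p ∷ l)))
∑-perms a []       F = sym (+-identityʳ (F (a ∷ []) + 0ℚ))
∑-perms {A} a (c ∷ cs) F = begin
  ∑ (perms (a ∷ as)) F
    ≡⟨ ∑-concatMap (insertAll a) (perms as) F ⟩
  ∑ (perms as) (λ l → ∑ (insertAll a l) F)
    ≡⟨ ∑-cong (perms as) split ⟩
  ∑ (perms as) (λ l → F (a ∷ l) + later l)
    ≡⟨ ∑-+ (perms as) (λ l → F (a ∷ l)) later ⟩
  ∑ (perms as) (λ l → F (a ∷ l)) + ∑ (perms as) later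
    ≡⟨ cong (∑ (perms as) (λ l → F (a ∷ l)) +_) (begin
         ∑ (perms as) later
           ≡⟨ ∑-perms c cs later ⟩
         ∑ (picks as) (λ p → ∑ (perms (proj₂ p)) (λ l → ∑ (insertAll a l) (λ l′ → F (proj₁ p ∷ l′))))
           ≡⟨ ∑-cong (picks as) (λ p → sym (∑-concatMap (insertAll a) (perms (proj₂ p)) (λ l → F (proj₁ p ∷ l)))) ⟩
         ∑ (picks as) (λ p → ∑ (perms (a ∷ proj₂ p)) (λ l → F (proj₁ p ∷ l)))
           ≡⟨ sym (∑-map (keep a) (picks as) (λ p → ∑ (perms (proj₂ p)) (λ l → F (proj₁ p ∷ l)))) ⟩
         ∑ (map (keep a) (picks as)) (λ p → ∑ (perms (proj₂ p)) (λ l → F (proj₁ p ∷ l))) ∎) ⟩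
  ∑ (picks (a ∷ as)) (λ p → ∑ (perms (proj₂ p)) (λ l → F (proj₁ p ∷ l))) ∎
  where
  open ≡-Reasoning
  as = c ∷ cs
  later : List A → ℚ
  later []       = 0ℚ
  later (b ∷ bs) = ∑ (insertAll a bs) (λ l → F (b ∷ l))
  split : ∀ l → ∑ (insertAll a l) F ≡ F (a ∷ l) + later l
  split []       = refl
  split (b ∷ bs) = cong (F (a ∷ b ∷ bs) +_) (∑-map (b ∷_) (insertAll a bs) F)

-- Absolute values and the drift of a product around a 4-cycle.

∣*∣≤ : ∀ {p q a b} → ∣ p ∣ ≤ a → ∣ q ∣ ≤ b → ∣ p * q ∣ ≤ a * b
∣*∣≤ {p} {q} p≤a q≤b = ≤-trans (≤-reflexive (∣p*q∣≡∣p∣*∣q∣ p q))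
  (*-mono (0≤∣p∣ q) (≤-trans (0≤∣p∣ p) p≤a) p≤a q≤b)

∣+∣≤ : ∀ {p q a b} → ∣ p ∣ ≤ a → ∣ q ∣ ≤ b → ∣ p + q ∣ ≤ a + b
∣+∣≤ {p} {q} p≤a q≤b = ≤-trans (∣p+q∣≤∣p∣+∣q∣ p q) (+-mono-≤ p≤a q≤b)

∣-∣≤ : ∀ {p a} → ∣ p ∣ ≤ a → ∣ - p ∣ ≤ a
∣-∣≤ {p} p≤a = ≤-trans (≤-reflexive (∣-p∣≡∣p∣ p)) p≤a

≤∣∣ : ∀ p → p ≤ ∣ p ∣
≤∣∣ p with ≤-total 0ℚ p
... | inj₁ 0≤p = ≤-reflexive (sym (0≤p⇒∣p∣≡p 0≤p))
... | inj₂ p≤0 = ≤-trans p≤0 (0≤∣p∣ p)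

∣∣≤ : ∀ {p a} → - a ≤ p → p ≤ a → ∣ p ∣ ≤ a
∣∣≤ {p} {a} -a≤p p≤a with ∣p∣≡p∨∣p∣≡-p p
... | inj₁ eq = ≤-trans (≤-reflexive eq) p≤a
... | inj₂ eq = ≤-trans (≤-reflexive eq) (≤-trans (neg-antimono-≤ -a≤p) (≤-reflexive (neg-neg a)))
  where
  neg-neg : ∀ a → - - a ≡ a
  neg-neg = solve-∀ ℚ-ring

∣-∣≤1 : ∀ {p q} → 0ℚ ≤ p → p ≤ 1ℚ → 0ℚ ≤ q → q ≤ 1ℚ → ∣ p - q ∣ ≤ 1ℚ
∣-∣≤1 {p} {q} 0≤p p≤1 0≤q q≤1 = ∣∣≤
  (≤-trans (neg-antimono-≤ q≤1) (≤-trans (≤-reflexive (sym (+-identityˡ (- q)))) (+-monoˡ-≤ (- q) 0≤p)))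
  (≤-trans (+-monoʳ-≤ p (neg-antimono-≤ 0≤q)) (≤-trans (≤-reflexive (+-identityʳ p)) p≤1))

-- With s₁, s₂, s₃ the elementary symmetric polynomials of a, b, c, e, this is -3 s₃ - θ (s₂ - d s₁
-- + d²). For θ = (ρ - 3) d, the drift of the weighted product exceeds -5 times the product by
-- exactly d times this, up to the common factor 1 + ρ.
drift-error : (a b c e d θ : ℚ) → ℚ
drift-error a b c e d θ =
  - (ι 3 * (b * (c * e) + a * (c * e) + a * b * e + a * b * c))
  - θ * (a * b + a * c + a * e + b * c + b * e + c * e - d * (a + b + c + e) + d * d)

-- Term by term the first bracket contributes at most 3 · 4 = 12 and the second at most 4 · (6 + 4 +
-- 1) = 44; 60 is a round bound for 56.
drift-error≤ : ∀ {a b c e d θ} → ∣ a ∣ ≤ 1ℚ → ∣ b ∣ ≤ 1ℚ → ∣ c ∣ ≤ 1ℚ → ∣ e ∣ ≤ 1ℚ → ∣ d ∣ ≤ 1ℚ → ∣ θ ∣ ≤ ι 4 →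
               drift-error a b c e d θ ≤ ι 60
drift-error≤ {a} {b} {c} {e} {d} {θ} a≤ b≤ c≤ e≤ d≤ θ≤ = ≤-trans (≤∣∣ _) (≤-trans
  (∣+∣≤
    (∣-∣≤ (∣*∣≤ {ι 3} {b = ι 4} ≤-refl (∣+∣≤ (∣+∣≤ (∣+∣≤ (∣*∣≤ b≤ (∣*∣≤ c≤ e≤)) (∣*∣≤ a≤ (∣*∣≤ c≤ e≤))) (∣*∣≤ (∣*∣≤ a≤ b≤) e≤)) (∣*∣≤ (∣*∣≤ a≤ b≤) c≤))))
    (∣-∣≤ (∣*∣≤ θ≤ (∣+∣≤ (∣+∣≤ (∣+∣≤ (∣+∣≤ (∣+∣≤ (∣+∣≤ (∣+∣≤ (∣*∣≤ a≤ b≤) (∣*∣≤ a≤ c≤)) (∣*∣≤ a≤ e≤)) (∣*∣≤ b≤ c≤)) (∣*∣≤ b≤ e≤)) (∣*∣≤ c≤ e≤))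
       (∣-∣≤ (∣*∣≤ d≤ (∣+∣≤ (∣+∣≤ (∣+∣≤ a≤ b≤) c≤) e≤)))) (∣*∣≤ d≤ d≤)))))
  (toWitness {a? = _ ≤? ι 60} _))

-- For centred variables a, b, c, e the drift of the 4-cycle product, weighted by
-- 1 + (number of remaining edges), is -5 times the product up to an error of order d.
drift-arith : ∀ ρ d a b c e → 0ℚ ≤ ρ → 0ℚ ≤ d → (1ℚ + ρ) * d ≤ 1ℚ →
  ∣ a ∣ ≤ 1ℚ → ∣ b ∣ ≤ 1ℚ → ∣ c ∣ ≤ 1ℚ → ∣ e ∣ ≤ 1ℚ →
  (1ℚ + ρ) * ((1ℚ + ρ) * (a * b * (c * e)) + ι 60 * d * ρ)
    + (- ((1ℚ + ρ) * (b * (c * e))) * (a + ρ * d) + (- ((1ℚ + ρ) * (a * (c * e))) * (b + ρ * d)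
        + (- ((1ℚ + ρ) * (a * b * e)) * (c + ρ * d) + - ((1ℚ + ρ) * (a * b * c)) * (e + ρ * d))))
    + (1ℚ + ρ) * (ι 5 * ((a - d) * (b - d) * ((c - d) * (e - d))))
  ≤ (1ℚ + ρ) * ((1ℚ + (1ℚ + ρ)) * ((a - d) * (b - d) * ((c - d) * (e - d))) + ι 60 * d * (1ℚ + ρ))
drift-arith ρ d a b c e 0≤ρ 0≤d kd≤1 a≤ b≤ c≤ e≤ =
  ≤-gap ((1ℚ + ρ) * (d * (ι 60 - drift-error a b c e d ((ρ - ι 3) * d))))
    (0≤-* 0≤k (0≤-* 0≤d (≤⇒0≤- (drift-error≤ a≤ b≤ c≤ e≤
      (∣∣≤ (≤-trans (toWitness {a? = - 1ℚ ≤? 0ℚ} _) 0≤d) d≤1) ∣θ∣≤4))))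
    (identity ρ d a b c e)
  where
  0≤k : 0ℚ ≤ 1ℚ + ρ
  0≤k = 0≤-+ (toWitness {a? = 0ℚ ≤? 1ℚ} _) 0≤ρ
  0≤ρd : 0ℚ ≤ ρ * d
  0≤ρd = 0≤-* 0≤ρ 0≤d
  split : ∀ ρ d → d + ρ * d ≡ (1ℚ + ρ) * d
  split = solve-∀ ℚ-ring
  d≤1 : d ≤ 1ℚ
  d≤1 = ≤-trans (≤-gap (ρ * d) 0≤ρd (split ρ d)) kd≤1
  ρd≤1 : ρ * d ≤ 1ℚ
  ρd≤1 = ≤-trans (≤-gap d 0≤d (trans (+-comm (ρ * d) d) (split ρ d))) kd≤1
  θ≡ : ∀ ρ d → ρ * d + - (ι 3 * d) ≡ (ρ - ι 3) * d
  θ≡ = solve-∀ ℚ-ring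
  ∣θ∣≤4 : ∣ (ρ - ι 3) * d ∣ ≤ ι 4
  ∣θ∣≤4 = ≤-trans (≤-reflexive (cong ∣_∣ (sym (θ≡ ρ d))))
    (∣+∣≤ {b = ι 3} (≤-trans (≤-reflexive (0≤p⇒∣p∣≡p 0≤ρd)) ρd≤1)
      (∣-∣≤ (∣*∣≤ {ι 3} {d} {b = 1ℚ} ≤-refl (≤-trans (≤-reflexive (0≤p⇒∣p∣≡p 0≤d)) d≤1))))
  identity : ∀ ρ d a b c e →
    (1ℚ + ρ) * ((1ℚ + ρ) * (a * b * (c * e)) + ι 60 * d * ρ)
      + (- ((1ℚ + ρ) * (b * (c * e))) * (a + ρ * d) + (- ((1ℚ + ρ) * (a * (c * e))) * (b + ρ * d)
          + (- ((1ℚ + ρ) * (a * b * e)) * (c + ρ * d) + - ((1ℚ + ρ) * (a * b * c)) * (e + ρ * d))))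
      + (1ℚ + ρ) * (ι 5 * ((a - d) * (b - d) * ((c - d) * (e - d))))
      + (1ℚ + ρ) * (d * (ι 60 - (- (ι 3 * (b * (c * e) + a * (c * e) + a * b * e + a * b * c))
          - (ρ - ι 3) * d * (a * b + a * c + a * e + b * c + b * e + c * e - d * (a + b + c + e) + d * d))))
    ≡ (1ℚ + ρ) * ((1ℚ + (1ℚ + ρ)) * ((a - d) * (b - d) * ((c - d) * (e - d))) + ι 60 * d * (1ℚ + ρ))
  identity = solve-∀ ℚ-ring

∑-affine₄ : ∀ {A : Set} (xs : List A) c t₁ t₂ t₃ t₄ (f₁ f₂ f₃ f₄ : A → ℚ) →
  ∑ xs (λ x → c + (t₁ * f₁ x + (t₂ * f₂ x + (t₃ * f₃ x + t₄ * f₄ x))))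
  ≡ ι (length xs) * c + (t₁ * ∑ xs f₁ + (t₂ * ∑ xs f₂ + (t₃ * ∑ xs f₃ + t₄ * ∑ xs f₄)))
∑-affine₄ xs c t₁ t₂ t₃ t₄ f₁ f₂ f₃ f₄ =
  trans (∑-+ xs _ _) (cong₂ _+_ (∑-const xs c)
    (trans (∑-+ xs _ _) (cong₂ _+_ (∑-*ˡ xs t₁ f₁)
      (trans (∑-+ xs _ _) (cong₂ _+_ (∑-*ˡ xs t₂ f₂)
        (trans (∑-+ xs _ _) (cong₂ _+_ (∑-*ˡ xs t₃ f₃) (∑-*ˡ xs t₄ f₄))))))))

δᶠ-disjoint : ∀ {n} {i j : Fin n} k → i ≢ j → δᶠ k i * δᶠ k j ≡ 0ℚ
δᶠ-disjoint {i = i} {j} k i≢j with k ≟ᶠ i | k ≟ᶠ j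
... | yes refl | yes refl = ⊥-elim (i≢j refl)
... | yes _    | no _     = refl
... | no _     | q        = *-zeroˡ (𝟙 ⌊ q ⌋)

-- Here l, l′ and k, k′ indicate that the removed edge has left end u, u′ and right end v, v′. An
-- edge is at most one of the four pairs of a nondegenerate cycle, so all terms of degree two or
-- more in these pairs vanish; `X` and `Y` are their cofactors of `l * l′` and `k * k′`.
cycle-expand : ∀ z₁ z₂ z₃ z₄ l l′ k k′ → l * l′ ≡ 0ℚ → k * k′ ≡ 0ℚ →
  (z₁ - l * k) * (z₂ - l * k′) * ((z₃ - l′ * k) * (z₄ - l′ * k′))
  ≡ z₁ * z₂ * (z₃ * z₄) - (l * k * (z₂ * (z₃ * z₄)) + (l * k′ * (z₁ * (z₃ * z₄))
      + (l′ * k * (z₁ * z₂ * z₄) + l′ * k′ * (z₁ * z₂ * z₃))))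
cycle-expand z₁ z₂ z₃ z₄ l l′ k k′ ll′≡0 kk′≡0 =
  trans (general z₁ z₂ z₃ z₄ l l′ k k′)
    (trans (cong₂ (λ x y → main + (x * X + y * Y)) ll′≡0 kk′≡0) (vanish main X Y))
  where
  main X Y : ℚ
  main = z₁ * z₂ * (z₃ * z₄) - (l * k * (z₂ * (z₃ * z₄)) + (l * k′ * (z₁ * (z₃ * z₄))
           + (l′ * k * (z₁ * z₂ * z₄) + l′ * k′ * (z₁ * z₂ * z₃))))
  X = (k * z₂ + k′ * z₁) * (k * z₄ + k′ * z₃)
  Y = l * l * (z₃ * z₄ - l′ * k * z₄ - l′ * k′ * z₃) + l′ * l′ * (z₁ * z₂ - l * k * z₂ - l * k′ * z₁)
        + l * l * (l′ * l′) * (k * k′)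
  vanish : ∀ p x y → p + (0ℚ * x + 0ℚ * y) ≡ p
  vanish = solve-∀ ℚ-ring
  general : ∀ z₁ z₂ z₃ z₄ l l′ k k′ →
    (z₁ - l * k) * (z₂ - l * k′) * ((z₃ - l′ * k) * (z₄ - l′ * k′))
    ≡ z₁ * z₂ * (z₃ * z₄) - (l * k * (z₂ * (z₃ * z₄)) + (l * k′ * (z₁ * (z₃ * z₄))
        + (l′ * k * (z₁ * z₂ * z₄) + l′ * k′ * (z₁ * z₂ * z₃))))
      + (l * l′ * ((k * z₂ + k′ * z₁) * (k * z₄ + k′ * z₃))
        + k * k′ * (l * l * (z₃ * z₄ - l′ * k * z₄ - l′ * k′ * z₃) + l′ * l′ * (z₁ * z₂ - l * k * z₂ - l * k′ * z₁)
            + l * l * (l′ * l′) * (k * k′)))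
  general = solve-∀ ℚ-ring

-- Remaining edges and the potential on closed 4-walks.

module Remaining {m n : ℕ} (ends : Fin m → Fin n × Fin n) where

  V : List (Fin n)
  V = allFin n

  d : ℚ
  d = recip (n *ᴺ n)

  joins : Fin n → Fin n → Fin m → ℚ
  joins u v f = δᶠ (proj₁ (ends f)) u * δᶠ (proj₂ (ends f)) v

  -- The subtracted term is the average of `η` over all n² vertex pairs, as `d` is 1/n².
  η ξ : List (Fin m) → Fin n → Fin n → ℚ
  η R u v = ∑ R (joins u v)
  ξ R u v = η R u v - ι (length R) * d

  -- Degenerate closed walks are included, because only the sum over all closed walks is a sum of
  -- squares, as Cauchy-Schwarz requires.
  Cycle : Set
  Cycle = (Fin n × Fin n) × (Fin n × Fin n)

  cycles : List Cycle
  cycles = cartesianProduct (cartesianProduct V V) (cartesianProduct V V)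

  degenerate : Cycle → Bool
  degenerate ((u , u′) , (v , v′)) = ⌊ u ≟ᶠ u′ ⌋ ∨ ⌊ v ≟ᶠ v′ ⌋

  Z : List (Fin m) → Cycle → ℚ
  Z R ((u , u′) , (v , v′)) = ξ R u v * ξ R u v′ * (ξ R u′ v * ξ R u′ v′)

  -- One fifth of pot bounds the expected sum of Z over the rest of the process.
  pot : List (Fin m) → Cycle → ℚ
  pot R t = if degenerate t then ι 5 * ι (length R)
            else (1ℚ + ι (length R)) * Z R t + ι 60 * d * ι (length R)

  Q Pot : List (Fin m) → ℚ
  Q   R = ∑ cycles (Z R)
  Pot R = ∑ cycles (pot R)

  -- An invariant inherited by every list of remaining edges, which keeps both terms of `ξ` in
  -- [0, 1]. The field `nonempty` makes `d` the true 1/n² and not the junk value of `recip`.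
  record Simple (R : List (Fin m)) : Set where
    field
      η≤1      : ∀ u v → η R u v ≤ 1ℚ
      length≤  : length R ≤ᴺ n *ᴺ n
      nonempty : ℕ.NonZero (n *ᴺ n)

    ≤1 : ∀ {r} → r ≤ᴺ n *ᴺ n → ι r * d ≤ 1ℚ
    ≤1 r≤ = ≤-trans (*-monoʳ (0≤recip (n *ᴺ n)) (ι-mono r≤)) (≤-reflexive (ι*recip (n *ᴺ n) {{nonempty}}))

  open Simple

  0≤joins : ∀ u v f → 0ℚ ≤ joins u v f
  0≤joins u v f = 0≤-* (0≤𝟙 ⌊ proj₁ (ends f) ≟ᶠ u ⌋) (0≤𝟙 ⌊ proj₂ (ends f) ≟ᶠ v ⌋)

  0≤η : ∀ R u v → 0ℚ ≤ η R u v
  0≤η R u v = 0≤∑ R (0≤joins u v)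

  0≤ιd : ∀ r → 0ℚ ≤ ι r * d
  0≤ιd r = 0≤-* (0≤ι r) (0≤recip (n *ᴺ n))

  Simple-pick : ∀ {R p} → Simple R → IsPick R p → Simple (proj₂ p)
  Simple-pick {R} {f , R′} simple pick = record
    { η≤1      = λ u v → ≤-trans (≤-gap (joins u v f) (0≤joins u v f) (trans (+-comm (η R′ u v) _) (pick-∑ pick (joins u v)))) (η≤1 simple u v)
    ; length≤  = ℕₚ.≤-trans (ℕₚ.n≤1+n _) (ℕₚ.≤-trans (ℕₚ.≤-reflexive (pick-length pick)) (length≤ simple))
    ; nonempty = nonempty simple
    }

  ∣ξ∣≤1 : ∀ {R} → Simple R → ∀ u v → ∣ ξ R u v ∣ ≤ 1ℚ
  ∣ξ∣≤1 {R} simple u v =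
    ∣-∣≤1 (0≤η R u v) (η≤1 simple u v) (0≤ιd (length R)) (≤1 simple (length≤ simple))

  Z≤1 : ∀ {R} → Simple R → ∀ t → Z R t ≤ 1ℚ
  Z≤1 {R} simple t@((u , u′) , (v , v′)) = ≤-trans (≤∣∣ (Z R t))
    (∣*∣≤ (∣*∣≤ (b u v) (b u v′)) (∣*∣≤ (b u′ v) (b u′ v′)))
    where
    b : ∀ u v → ∣ ξ R u v ∣ ≤ 1ℚ
    b = ∣ξ∣≤1 simple

  pick-ι : ∀ {a as p} → IsPick (a ∷ as) p → ι (length (proj₂ p)) ≡ ι (length {A = Fin m} as)
  pick-ι pick = cong ι (ℕₚ.suc-injective (pick-length pick))

  -- With a repeated vertex the linear expansion fails. Such walks are only O(n³) out of n⁴, so the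
  -- crude bound Z ≤ 1 is enough, paid for by losing 5 per removed edge.
  drift-degenerate : ∀ a as → Simple (a ∷ as) → ∀ t → let r = ι (length (a ∷ as)) in
    ∑ (picks (a ∷ as)) (λ p → ι 5 * ι (length (proj₂ p))) + r * (ι 5 * Z (a ∷ as) t) ≤ r * (ι 5 * r)
  drift-degenerate a as simple t = ≤-trans
    (≤-reflexive (cong (_+ (1ℚ + ρ) * (ι 5 * Z R t)) (trans
      (∑-cong-All {f = λ p → ι 5 * ι (length (proj₂ p))} {λ _ → ι 5 * ρ}
        (All-map (λ pick → cong (ι 5 *_) (pick-ι pick)) (picks-IsPick R)))
      (∑-picks-const R (ι 5 * ρ)))))
    (≤-gap ((1ℚ + ρ) * (ι 5 * (1ℚ - Z R t)))
      (0≤-* (0≤ι (length R)) (0≤-* (0≤ι 5) (≤⇒0≤- (Z≤1 simple t)))) (identity ρ (Z R t)))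
    where
    R = a ∷ as
    ρ = ι (length as)
    identity : ∀ ρ z → (1ℚ + ρ) * (ι 5 * ρ) + (1ℚ + ρ) * (ι 5 * z) + (1ℚ + ρ) * (ι 5 * (1ℚ - z))
                       ≡ (1ℚ + ρ) * (ι 5 * (1ℚ + ρ))
    identity = solve-∀ ℚ-ring

  -- Summing `cycle-expand` over the removed edge turns each product of indicators into a count `η`;
  -- what results is the left side of `drift-arith`.
  drift-nondegenerate : ∀ a as → Simple (a ∷ as) → ∀ {u u′ v v′} → u ≢ u′ → v ≢ v′ →
    let r = ι (length (a ∷ as)); t = (u , u′) , (v , v′) in
    ∑ (picks (a ∷ as)) (λ p → (1ℚ + ι (length (proj₂ p))) * Z (proj₂ p) t + ι 60 * d * ι (length (proj₂ p)))
      + r * (ι 5 * Z (a ∷ as) t)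
    ≤ r * ((1ℚ + r) * Z (a ∷ as) t + ι 60 * d * r)
  drift-nondegenerate a as simple {u} {u′} {v} {v′} u≢u′ v≢v′ = begin
    ∑ (picks R) (λ p → (1ℚ + ι (length (proj₂ p))) * Z (proj₂ p) t + ι 60 * d * ι (length (proj₂ p)))
      + (1ℚ + ρ) * (ι 5 * Z R t)
      ≡⟨ cong₂ (λ x y → x + (1ℚ + ρ) * (ι 5 * y)) sum-after Z≡ ⟩
    (1ℚ + ρ) * ((1ℚ + ρ) * (z₁ * z₂ * (z₃ * z₄)) + ι 60 * d * ρ)
      + (- ((1ℚ + ρ) * (z₂ * (z₃ * z₄))) * (z₁ + ρ * d) + (- ((1ℚ + ρ) * (z₁ * (z₃ * z₄))) * (z₂ + ρ * d)
          + (- ((1ℚ + ρ) * (z₁ * z₂ * z₄)) * (z₃ + ρ * d) + - ((1ℚ + ρ) * (z₁ * z₂ * z₃)) * (z₄ + ρ * d))))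
      + (1ℚ + ρ) * (ι 5 * ((z₁ - d) * (z₂ - d) * ((z₃ - d) * (z₄ - d))))
      ≤⟨ drift-arith ρ d z₁ z₂ z₃ z₄ (0≤ι (length as)) (0≤recip (n *ᴺ n)) (≤1 simple (length≤ simple))
           (∣z∣≤1 u v) (∣z∣≤1 u v′) (∣z∣≤1 u′ v) (∣z∣≤1 u′ v′) ⟩
    (1ℚ + ρ) * ((1ℚ + (1ℚ + ρ)) * ((z₁ - d) * (z₂ - d) * ((z₃ - d) * (z₄ - d))) + ι 60 * d * (1ℚ + ρ))
      ≡⟨ cong (λ y → (1ℚ + ρ) * ((1ℚ + (1ℚ + ρ)) * y + ι 60 * d * (1ℚ + ρ))) (sym Z≡) ⟩
    (1ℚ + ρ) * ((1ℚ + (1ℚ + ρ)) * Z R t + ι 60 * d * (1ℚ + ρ)) ∎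
    where
    open ≤-Reasoning
    R = a ∷ as
    t = (u , u′) , (v , v′)
    ρ = ι (length as)
    -- Centred with the number of edges after the removal: `ξ` is then `z - d` before it and
    -- `z - joins` after it.
    z : Fin n → Fin n → ℚ
    z u v = η R u v - ρ * d
    z₁ = z u v
    z₂ = z u v′
    z₃ = z u′ v
    z₄ = z u′ v′
    ∣z∣≤1 : ∀ u v → ∣ z u v ∣ ≤ 1ℚ
    ∣z∣≤1 u v = ∣-∣≤1 (0≤η R u v) (η≤1 simple u v) (0≤ιd (length as))
      (≤1 simple (ℕₚ.≤-trans (ℕₚ.n≤1+n _) (length≤ simple)))
    ξ≡ : ∀ u v → ξ R u v ≡ z u v - d
    ξ≡ u v = shift (η R u v) ρ d
      where
      shift : ∀ h ρ d → h - (1ℚ + ρ) * d ≡ h - ρ * d - d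
      shift = solve-∀ ℚ-ring
    Z≡ : Z R t ≡ (z₁ - d) * (z₂ - d) * ((z₃ - d) * (z₄ - d))
    Z≡ = cong₂ _*_ (cong₂ _*_ (ξ≡ u v) (ξ≡ u v′)) (cong₂ _*_ (ξ≡ u′ v) (ξ≡ u′ v′))
    η≡ : ∀ u v → η R u v ≡ z u v + ρ * d
    η≡ u v = shift (η R u v) (ρ * d)
      where
      shift : ∀ h x → h ≡ h - x + x
      shift = solve-∀ ℚ-ring
    ξ-after : ∀ {p} → IsPick R p → ∀ u v → ξ (proj₂ p) u v ≡ z u v - joins u v (proj₁ p)
    ξ-after {f , R′} pick u v = trans
      (cong (λ x → η R′ u v - x * d) (pick-ι pick))
      (trans (shift (joins u v f) (η R′ u v) (ρ * d)) (cong (λ x → x - ρ * d - joins u v f) (pick-∑ pick (joins u v))))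
      where
      shift : ∀ j h x → h - x ≡ j + h - x - j
      shift = solve-∀ ℚ-ring
    c t₁ t₂ t₃ t₄ : ℚ
    c  = (1ℚ + ρ) * (z₁ * z₂ * (z₃ * z₄)) + ι 60 * d * ρ
    t₁ = - ((1ℚ + ρ) * (z₂ * (z₃ * z₄)))
    t₂ = - ((1ℚ + ρ) * (z₁ * (z₃ * z₄)))
    t₃ = - ((1ℚ + ρ) * (z₁ * z₂ * z₄))
    t₄ = - ((1ℚ + ρ) * (z₁ * z₂ * z₃))
    distribute : ∀ k w z₁ z₂ z₃ z₄ j₁ j₂ j₃ j₄ →
      k * (z₁ * z₂ * (z₃ * z₄) - (j₁ * (z₂ * (z₃ * z₄)) + (j₂ * (z₁ * (z₃ * z₄))
        + (j₃ * (z₁ * z₂ * z₄) + j₄ * (z₁ * z₂ * z₃))))) + w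
      ≡ k * (z₁ * z₂ * (z₃ * z₄)) + w + (- (k * (z₂ * (z₃ * z₄))) * j₁ + (- (k * (z₁ * (z₃ * z₄))) * j₂
        + (- (k * (z₁ * z₂ * z₄)) * j₃ + - (k * (z₁ * z₂ * z₃)) * j₄)))
    distribute = solve-∀ ℚ-ring
    after : ∀ {p} → IsPick R p →
      (1ℚ + ι (length (proj₂ p))) * Z (proj₂ p) t + ι 60 * d * ι (length (proj₂ p))
      ≡ c + (t₁ * joins u v (proj₁ p) + (t₂ * joins u v′ (proj₁ p)
           + (t₃ * joins u′ v (proj₁ p) + t₄ * joins u′ v′ (proj₁ p))))
    after {f , R′} pick = trans
      (cong₂ (λ x y → (1ℚ + x) * y + ι 60 * d * x) (pick-ι pick) (trans
        (cong₂ _*_ (cong₂ _*_ (ξ-after pick u v) (ξ-after pick u v′)) (cong₂ _*_ (ξ-after pick u′ v) (ξ-after pick u′ v′)))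
        (cycle-expand z₁ z₂ z₃ z₄ (δᶠ (proj₁ (ends f)) u) (δᶠ (proj₁ (ends f)) u′) (δᶠ (proj₂ (ends f)) v) (δᶠ (proj₂ (ends f)) v′) (δᶠ-disjoint (proj₁ (ends f)) u≢u′) (δᶠ-disjoint (proj₂ (ends f)) v≢v′))))
      (distribute (1ℚ + ρ) (ι 60 * d * ρ) z₁ z₂ z₃ z₄ (joins u v f) (joins u v′ f) (joins u′ v f) (joins u′ v′ f))
    sum-after :
      ∑ (picks R) (λ p → (1ℚ + ι (length (proj₂ p))) * Z (proj₂ p) t + ι 60 * d * ι (length (proj₂ p)))
      ≡ (1ℚ + ρ) * c + (t₁ * (z₁ + ρ * d) + (t₂ * (z₂ + ρ * d) + (t₃ * (z₃ + ρ * d) + t₄ * (z₄ + ρ * d))))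
    sum-after = trans (∑-cong-All (All-map after (picks-IsPick R))) (trans
      (∑-picks R (λ f → c + (t₁ * joins u v f + (t₂ * joins u v′ f + (t₃ * joins u′ v f + t₄ * joins u′ v′ f)))))
      (trans (∑-affine₄ R c t₁ t₂ t₃ t₄ (joins u v) (joins u v′) (joins u′ v) (joins u′ v′))
        (cong ((1ℚ + ρ) * c +_) (cong₂ _+_ (cong (t₁ *_) (η≡ u v)) (cong₂ _+_ (cong (t₂ *_) (η≡ u v′))
          (cong₂ _+_ (cong (t₃ *_) (η≡ u′ v)) (cong (t₄ *_) (η≡ u′ v′))))))))

  -- Stated as a sum over the removed edge, which avoids dividing by the number of remaining edges:
  -- on average `pot` falls by at least five times the current product.
  pot-drift : ∀ {R} → Simple R → ∀ t →
    ∑ (picks R) (λ p → pot (proj₂ p) t) + ι (length R) * (ι 5 * Z R t) ≤ ι (length R) * pot R t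
  pot-drift {[]} simple t = ≤-reflexive (empty (ι 5 * Z [] t) (pot [] t))
    where
    empty : ∀ x y → 0ℚ + 0ℚ * x ≡ 0ℚ * y
    empty = solve-∀ ℚ-ring
  pot-drift {a ∷ as} simple ((u , u′) , (v , v′)) with u ≟ᶠ u′ | v ≟ᶠ v′
  ... | yes _   | _       = drift-degenerate a as simple _
  ... | no _    | yes _   = drift-degenerate a as simple _
  ... | no u≢u′ | no v≢v′ = drift-nondegenerate a as simple u≢u′ v≢v′

  Pot-drift : ∀ {R} → Simple R →
    ∑ (picks R) (λ p → Pot (proj₂ p)) + ι (length R) * (ι 5 * Q R) ≤ ι (length R) * Pot R
  Pot-drift {R} simple = begin
    ∑ (picks R) (λ p → Pot (proj₂ p)) + ι (length R) * (ι 5 * Q R)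
      ≡⟨ cong₂ _+_ (∑-comm (picks R) cycles (λ p → pot (proj₂ p)))
           (sym (trans (∑-*ˡ cycles (ι (length R)) _) (cong (ι (length R) *_) (∑-*ˡ cycles (ι 5) (Z R))))) ⟩
    ∑ cycles (λ t → ∑ (picks R) (λ p → pot (proj₂ p) t)) + ∑ cycles (λ t → ι (length R) * (ι 5 * Z R t))
      ≡⟨ sym (∑-+ cycles _ _) ⟩
    ∑ cycles (λ t → ∑ (picks R) (λ p → pot (proj₂ p) t) + ι (length R) * (ι 5 * Z R t))
      ≤⟨ ∑-mono cycles (pot-drift simple) ⟩
    ∑ cycles (λ t → ι (length R) * pot R t)
      ≡⟨ ∑-*ˡ cycles (ι (length R)) (pot R) ⟩
    ι (length R) * Pot R ∎
    where open ≤-Reasoning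

-- Discrepancy of the remaining edges.

-- The gap is l (1 - s²) + l (s - x/l)². This linearised form avoids square roots, and carrying the
-- inverse of l as a variable keeps everything polynomial for the ring solver.
weighted-AM-GM : ∀ s x l l⁻¹ → s * s ≤ 1ℚ → 0ℚ ≤ l → l * l⁻¹ ≡ 1ℚ → ι 2 * (s * x) ≤ l + l⁻¹ * (x * x)
weighted-AM-GM s x l l⁻¹ s²≤1 0≤l ll⁻¹≡1 = ≤-gap (l * (1ℚ - s * s) + l * ((s - l⁻¹ * x) * (s - l⁻¹ * x)))
  (0≤-+ (0≤-* 0≤l (≤⇒0≤- s²≤1)) (0≤-* 0≤l (0≤x² (s - l⁻¹ * x))))
  (trans (general s x l l⁻¹) (trans (cong (λ t → l + (ι 2 * (s * x) * (1ℚ - t) + t * (l⁻¹ * (x * x)))) ll⁻¹≡1)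
    (special l (ι 2 * (s * x)) (l⁻¹ * (x * x)))))
  where
  general : ∀ s x l l⁻¹ → ι 2 * (s * x) + (l * (1ℚ - s * s) + l * ((s - l⁻¹ * x) * (s - l⁻¹ * x)))
                          ≡ l + (ι 2 * (s * x) * (1ℚ - l * l⁻¹) + l * l⁻¹ * (l⁻¹ * (x * x)))
  general = solve-∀ ℚ-ring
  special : ∀ l y z → l + (y * (1ℚ - 1ℚ) + 1ℚ * z) ≡ l + z
  special = solve-∀ ℚ-ring

module Discrepancy {m n : ℕ} (ends : Fin m → Fin n × Fin n) where

  open Remaining ends public

  length-V : length V ≡ n
  length-V = length-tabulate id

  ∑V-const : ∀ c → ∑ V (λ _ → c) ≡ ι n * c
  ∑V-const c = trans (∑-const V c) (cong (λ k → ι k * c) length-V)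

  disc : List (Fin m) → (Fin n → ℚ) → (Fin n → ℚ) → ℚ
  disc R σ τ = ∑ V (λ u → σ u * ∑ V (λ v → τ v * ξ R u v))

  codegree : List (Fin m) → Fin n → Fin n → ℚ
  codegree R v v′ = ∑ V (λ u → ξ R u v * ξ R u v′)

  -- Opening each square introduces two independent left vertices u and u′, hence the four factors
  -- of the closed walk u v u′ v′.
  ∑-codegree² : ∀ R → ∑ V (λ v → ∑ V (λ v′ → codegree R v v′ * codegree R v v′)) ≡ Q R
  ∑-codegree² R = begin
    ∑ V (λ v → ∑ V (λ v′ → codegree R v v′ * codegree R v v′))
      ≡⟨ ∑-cong V (λ v → ∑-cong V (λ v′ → trans
           (∑-product V V (λ u → ξ R u v * ξ R u v′) (λ u → ξ R u v * ξ R u v′))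
           (sym (∑-× V V (λ us → Z R (us , v , v′)))))) ⟩
    ∑ V (λ v → ∑ V (λ v′ → ∑ V² (λ us → Z R (us , v , v′))))
      ≡⟨ sym (∑-× V V (λ vs → ∑ V² (λ us → Z R (us , vs)))) ⟩
    ∑ V² (λ vs → ∑ V² (λ us → Z R (us , vs)))
      ≡⟨ ∑-comm V² V² (λ vs us → Z R (us , vs)) ⟩
    ∑ V² (λ us → ∑ V² (λ vs → Z R (us , vs)))
      ≡⟨ sym (∑-× V² V² (Z R)) ⟩
    Q R ∎
    where
    open ≡-Reasoning
    V² = cartesianProduct V V

  -- Cauchy–Schwarz twice, each time in the form 2sx ≤ l + x²/l.
  disc≤ : ∀ R σ τ → (∀ u → σ u * σ u ≤ 1ℚ) → (∀ v → τ v * τ v ≤ 1ℚ) →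
    ∀ l l⁻¹ k k⁻¹ → 0ℚ ≤ l → 0ℚ ≤ l⁻¹ → l * l⁻¹ ≡ 1ℚ → 0ℚ ≤ k → k * k⁻¹ ≡ 1ℚ →
    ι 4 * disc R σ τ ≤ ι 2 * (ι n * l) + l⁻¹ * (ι n * (ι n * k) + k⁻¹ * Q R)
  disc≤ R σ τ σ²≤1 τ²≤1 l l⁻¹ k k⁻¹ 0≤l 0≤l⁻¹ ll⁻¹≡1 0≤k kk⁻¹≡1 = begin
    ι 4 * disc R σ τ
      ≡⟨ four (disc R σ τ) ⟩
    ι 2 * (ι 2 * disc R σ τ)
      ≤⟨ *-monoˡ (0≤ι 2) first ⟩
    ι 2 * (ι n * l + l⁻¹ * S)
      ≡⟨ two (ι n * l) l⁻¹ S ⟩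
    ι 2 * (ι n * l) + l⁻¹ * (ι 2 * S)
      ≤⟨ +-monoʳ-≤ (ι 2 * (ι n * l)) (*-monoˡ 0≤l⁻¹ second) ⟩
    ι 2 * (ι n * l) + l⁻¹ * (ι n * (ι n * k) + k⁻¹ * Q R) ∎
    where
    open ≤-Reasoning
    four : ∀ x → ι 4 * x ≡ ι 2 * (ι 2 * x)
    four = solve-∀ ℚ-ring
    two : ∀ a b s → ι 2 * (a + b * s) ≡ ι 2 * a + b * (ι 2 * s)
    two = solve-∀ ℚ-ring
    swap : ∀ a x b y → a * x * (b * y) ≡ a * b * (x * y)
    swap = solve-∀ ℚ-ring
    square : ∀ a b → a * b * (a * b) ≡ a * a * (b * b)
    square = solve-∀ ℚ-ring
    X : Fin n → ℚ
    X u = ∑ V (λ v → τ v * ξ R u v)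
    S = ∑ V (λ u → X u * X u)
    first : ι 2 * disc R σ τ ≤ ι n * l + l⁻¹ * S
    first = begin
      ι 2 * disc R σ τ                    ≡⟨ sym (∑-*ˡ V (ι 2) (λ u → σ u * X u)) ⟩
      ∑ V (λ u → ι 2 * (σ u * X u))       ≤⟨ ∑-mono V (λ u → weighted-AM-GM (σ u) (X u) l l⁻¹ (σ²≤1 u) 0≤l ll⁻¹≡1) ⟩
      ∑ V (λ u → l + l⁻¹ * (X u * X u))   ≡⟨ ∑-+ V (λ _ → l) (λ u → l⁻¹ * (X u * X u)) ⟩
      ∑ V (λ _ → l) + ∑ V (λ u → l⁻¹ * (X u * X u))
                                          ≡⟨ cong₂ _+_ (∑V-const l) (∑-*ˡ V l⁻¹ (λ u → X u * X u)) ⟩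
      ι n * l + l⁻¹ * S                   ∎
    S≡ : S ≡ ∑ V (λ v → ∑ V (λ v′ → τ v * τ v′ * codegree R v v′))
    S≡ = trans
      (∑-cong V (λ u → ∑-product V V (λ v → τ v * ξ R u v) (λ v → τ v * ξ R u v)))
      (trans (∑-comm V V (λ u v → ∑ V (λ v′ → τ v * ξ R u v * (τ v′ * ξ R u v′))))
        (∑-cong V (λ v → trans (∑-comm V V (λ u v′ → τ v * ξ R u v * (τ v′ * ξ R u v′)))
          (∑-cong V (λ v′ → trans (∑-cong V (λ u → swap (τ v) (ξ R u v) (τ v′) (ξ R u v′)))
            (∑-*ˡ V (τ v * τ v′) (λ u → ξ R u v * ξ R u v′)))))))
    ττ²≤1 : ∀ v v′ → τ v * τ v′ * (τ v * τ v′) ≤ 1ℚ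
    ττ²≤1 v v′ = ≤-trans (≤-reflexive (square (τ v) (τ v′)))
      (*-mono (0≤x² (τ v′)) (toWitness {a? = 0ℚ ≤? 1ℚ} _) (τ²≤1 v) (τ²≤1 v′))
    second : ι 2 * S ≤ ι n * (ι n * k) + k⁻¹ * Q R
    second = begin
      ι 2 * S
        ≡⟨ cong (ι 2 *_) S≡ ⟩
      ι 2 * ∑ V (λ v → ∑ V (λ v′ → τ v * τ v′ * codegree R v v′))
        ≡⟨ sym (trans (∑-cong V (λ v → ∑-*ˡ V (ι 2) _)) (∑-*ˡ V (ι 2) _)) ⟩
      ∑ V (λ v → ∑ V (λ v′ → ι 2 * (τ v * τ v′ * codegree R v v′)))
        ≤⟨ ∑-mono V (λ v → ∑-mono V (λ v′ →
             weighted-AM-GM (τ v * τ v′) (codegree R v v′) k k⁻¹ (ττ²≤1 v v′) 0≤k kk⁻¹≡1)) ⟩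
      ∑ V (λ v → ∑ V (λ v′ → k + k⁻¹ * (codegree R v v′ * codegree R v v′)))
        ≡⟨ ∑-cong V (λ v → trans (∑-+ V (λ _ → k) _) (cong₂ _+_ (∑V-const k) (∑-*ˡ V k⁻¹ _))) ⟩
      ∑ V (λ v → ι n * k + k⁻¹ * ∑ V (λ v′ → codegree R v v′ * codegree R v v′))
        ≡⟨ trans (∑-+ V (λ _ → ι n * k) _) (cong₂ _+_ (∑V-const (ι n * k)) (∑-*ˡ V k⁻¹ _)) ⟩
      ι n * (ι n * k) + k⁻¹ * ∑ V (λ v → ∑ V (λ v′ → codegree R v v′ * codegree R v v′))
        ≡⟨ cong (λ q → ι n * (ι n * k) + k⁻¹ * q) (∑-codegree² R) ⟩
      ι n * (ι n * k) + k⁻¹ * Q R ∎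

  -- The second term is the weight that a perfectly even spread of the edges would give; `disc` is
  -- the deviation from it.
  ∑-ends : ∀ R σ τ → ∑ R (λ f → σ (proj₁ (ends f)) * τ (proj₂ (ends f)))
                     ≡ disc R σ τ + ι (length R) * d * (∑ V σ * ∑ V τ)
  ∑-ends R σ τ = begin
    ∑ R (λ f → σ (proj₁ (ends f)) * τ (proj₂ (ends f)))
      ≡⟨ ∑-cong R (λ f → trans
           (sym (cong₂ _*_ (∑-δᶠ (proj₁ (ends f)) σ) (∑-δᶠ (proj₂ (ends f)) τ)))
           (trans (∑-product V V _ _) (∑-cong V (λ u → ∑-cong V (λ v → reorder (δᶠ (proj₁ (ends f)) u) (σ u) (δᶠ (proj₂ (ends f)) v) (τ v)))))) ⟩
    ∑ R (λ f → ∑ V (λ u → ∑ V (λ v → σ u * τ v * joins u v f)))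
      ≡⟨ trans (∑-comm R V _) (∑-cong V (λ u → trans (∑-comm R V _)
           (∑-cong V (λ v → ∑-*ˡ R (σ u * τ v) (joins u v))))) ⟩
    ∑ V (λ u → ∑ V (λ v → σ u * τ v * η R u v))
      ≡⟨ ∑-cong V (λ u → ∑-cong V (λ v → centre (σ u) (τ v) (η R u v) (ι (length R) * d))) ⟩
    ∑ V (λ u → ∑ V (λ v → σ u * (τ v * ξ R u v) + ι (length R) * d * (σ u * τ v)))
      ≡⟨ ∑-cong V (λ u → trans (∑-+ V _ _) (cong₂ _+_ (∑-*ˡ V (σ u) _) (∑-*ˡ V (ι (length R) * d) _))) ⟩
    ∑ V (λ u → σ u * ∑ V (λ v → τ v * ξ R u v) + ι (length R) * d * ∑ V (λ v → σ u * τ v))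
      ≡⟨ trans (∑-+ V _ _) (cong (disc R σ τ +_) (trans (∑-*ˡ V (ι (length R) * d) _)
           (cong (ι (length R) * d *_) (sym (∑-product V V σ τ))))) ⟩
    disc R σ τ + ι (length R) * d * (∑ V σ * ∑ V τ) ∎
    where
    open ≡-Reasoning
    reorder : ∀ i s j t → i * s * (j * t) ≡ s * t * (i * j)
    reorder = solve-∀ ℚ-ring
    centre : ∀ s t h x → s * t * h ≡ s * (t * (h - x)) + x * (s * t)
    centre = solve-∀ ℚ-ring

-- The energy that pays for the growth of 1/(s + K).

module Energy {m n : ℕ} (ends : Fin m → Fin n × Fin n) (A b g θ : ℚ) (N₀ : ℕ)
  (0≤b : 0ℚ ≤ b) (0≤g : 0ℚ ≤ g) (0≤θ : 0ℚ ≤ θ) (θN₀≡1 : θ * ι N₀ ≡ 1ℚ)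
  where

  open Discrepancy ends public
  open Remaining.Simple

  -- g * (θ * D R) pays for the discrepancy D R while more than N₀ edges remain; the last N₀
  -- edges are paid for by g each.
  D energy : List (Fin m) → ℚ
  D      R = A + b * (ι 5 * Q R)
  energy R = d * ι (length R) + g * (θ * (A * ι (length R) + b * Pot R) + ι (length R ⊓ᴺ N₀))

  -- For the indicators of the unmatched vertices this counts the remaining edges that join two of
  -- them.
  hits : List (Fin m) → (Fin n → ℚ) → (Fin n → ℚ) → ℚ
  hits R σ τ = ∑ R (λ f → σ (proj₁ (ends f)) * τ (proj₂ (ends f)))

  module _ (R : List (Fin m)) (σ τ : Fin n → ℚ) (s Δ : ℚ)
    (0≤σ : ∀ u → 0ℚ ≤ σ u) (σ≤1 : ∀ u → σ u ≤ 1ℚ) (0≤τ : ∀ v → 0ℚ ≤ τ v) (τ≤1 : ∀ v → τ v ≤ 1ℚ)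
    (∑σ≡s : ∑ V σ ≡ s) (∑τ≡s : ∑ V τ ≡ s)
    (0≤Δ : 0ℚ ≤ Δ) (Δs²≤1 : Δ * (s * s) ≤ 1ℚ) (Δ≤g : Δ ≤ g)
    (0≤D : 0ℚ ≤ D R) (disc≤D : disc R σ τ ≤ D R)
    where

    private
      r = ι (length R)

    -- For the end of the process, where evenness is not exploited: every remaining edge is counted
    -- as a hit, and its jump is bounded by g.
    hits≤few : Δ * hits R σ τ ≤ r * d + g * (θ * (r * D R) + r)
    hits≤few = begin
      Δ * hits R σ τ  ≤⟨ *-mono 0≤hits 0≤g Δ≤g hits≤r ⟩
      g * r           ≤⟨ ≤-gap (r * d + g * (θ * (r * D R)))
                           (0≤-+ (0≤ιd (length R)) (0≤-* 0≤g (0≤-* 0≤θ (0≤-* (0≤ι (length R)) 0≤D))))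
                           (identity g r (r * d) (θ * (r * D R))) ⟩
      r * d + g * (θ * (r * D R) + r) ∎
      where
      open ≤-Reasoning
      identity : ∀ g r x y → g * r + (x + g * y) ≡ x + g * (y + r)
      identity = solve-∀ ℚ-ring
      0≤hits : 0ℚ ≤ hits R σ τ
      0≤hits = 0≤∑ R (λ f → 0≤-* (0≤σ (proj₁ (ends f))) (0≤τ (proj₂ (ends f))))
      hits≤r : hits R σ τ ≤ r
      hits≤r = ≤-trans
        (∑-mono R {g = λ _ → 1ℚ * 1ℚ} (λ f → *-mono (0≤τ (proj₂ (ends f))) (0≤ι 1) (σ≤1 (proj₁ (ends f))) (τ≤1 (proj₂ (ends f)))))
        (≤-reflexive (trans (∑-const R (1ℚ * 1ℚ)) (*-identityʳ r)))

    -- The evenly spread hits cost at most `r * d` because Δ s² ≤ 1; the discrepancy is affordable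
    -- because θ r ≥ θ N₀ = 1.
    hits≤many : N₀ ≤ᴺ length R → Δ * hits R σ τ ≤ r * d + g * (θ * (r * D R))
    hits≤many N₀≤r = begin
      Δ * hits R σ τ
        ≡⟨ cong (Δ *_) (trans (∑-ends R σ τ) (cong₂ (λ x y → disc R σ τ + r * d * (x * y)) ∑σ≡s ∑τ≡s)) ⟩
      Δ * (disc R σ τ + r * d * (s * s))
        ≡⟨ expand Δ (disc R σ τ) (r * d) (s * s) ⟩
      r * d * (Δ * (s * s)) + Δ * disc R σ τ
        ≤⟨ +-mono-≤ (*-monoˡ (0≤ιd (length R)) Δs²≤1) (*-monoˡ 0≤Δ disc≤D) ⟩
      r * d * 1ℚ + Δ * D R
        ≤⟨ +-mono-≤ (≤-reflexive (*-identityʳ (r * d))) (*-mono 0≤D 0≤g Δ≤g D≤θrD) ⟩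
      r * d + g * (θ * (r * D R)) ∎
      where
      open ≤-Reasoning
      expand : ∀ Δ x y z → Δ * (x + y * z) ≡ y * (Δ * z) + Δ * x
      expand = solve-∀ ℚ-ring
      D≤θrD : D R ≤ θ * (r * D R)
      D≤θrD = begin
        D R                ≡⟨ sym (*-identityˡ (D R)) ⟩
        1ℚ * D R           ≤⟨ *-monoʳ 0≤D (≤-trans (≤-reflexive (sym θN₀≡1)) (*-monoˡ 0≤θ (ι-mono N₀≤r))) ⟩
        θ * r * D R        ≡⟨ *-assoc θ r (D R) ⟩
        θ * (r * D R)      ∎

  -- Each part of `energy` falls by what it pays for. On average over the removed edge, the first
  -- part drops by d and covers the evenly spread hits; the part with θ drops by at least `θ * D R`,
  -- by `Pot-drift`, and covers the discrepancy; the last part drops by one in each of the last N₀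
  -- arrivals.
  energy-drift : ∀ {R} → Simple R → ∀ σ τ s Δ →
    (∀ u → 0ℚ ≤ σ u) → (∀ u → σ u ≤ 1ℚ) → (∀ v → 0ℚ ≤ τ v) → (∀ v → τ v ≤ 1ℚ) →
    ∑ V σ ≡ s → ∑ V τ ≡ s → 0ℚ ≤ Δ → Δ * (s * s) ≤ 1ℚ → Δ ≤ g → 0ℚ ≤ D R → disc R σ τ ≤ D R →
    ∑ (picks R) (λ p → energy (proj₂ p)) + Δ * hits R σ τ ≤ ι (length R) * energy R
  energy-drift {[]} simple σ τ s Δ _ _ _ _ _ _ _ _ _ _ _ = ≤-reflexive (empty Δ (energy []))
    where
    empty : ∀ x y → 0ℚ + x * 0ℚ ≡ 0ℚ * y
    empty = solve-∀ ℚ-ring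
  energy-drift {R@(a ∷ as)} simple σ τ s Δ 0≤σ σ≤1 0≤τ τ≤1 ∑σ ∑τ 0≤Δ Δs²≤1 Δ≤g 0≤D disc≤D = begin
    ∑ (picks R) (λ p → energy (proj₂ p)) + Δ * hits R σ τ
      ≡⟨ cong (_+ Δ * hits R σ τ) sum-after ⟩
    r * c + g * (θ * b) * S + Δ * hits R σ τ
      ≤⟨ +-monoʳ-≤ (r * c + g * (θ * b) * S) hits≤ ⟩
    r * c + g * (θ * b) * S + (r * d + g * (θ * (r * D R) + r * (M - M′)))
      ≤⟨ ≤-gap (g * (θ * b) * (r * Pot R - (S + r * (ι 5 * Q R))))
           (0≤-* (0≤-* 0≤g (0≤-* 0≤θ 0≤b)) (≤⇒0≤- (Pot-drift simple)))
           (identity ρ d g θ b A (Q R) (Pot R) S M M′) ⟩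
    r * energy R ∎
    where
    open ≤-Reasoning
    ρ = ι (length as)
    r = 1ℚ + ρ
    M = ι (suc (length as) ⊓ᴺ N₀)
    M′ = ι (length as ⊓ᴺ N₀)
    S = ∑ (picks R) (λ p → Pot (proj₂ p))
    c = d * ρ + g * (θ * (A * ρ) + M′)
    identity : ∀ ρ d g θ b A q P S M M′ →
      (1ℚ + ρ) * (d * ρ + g * (θ * (A * ρ) + M′)) + g * (θ * b) * S
        + ((1ℚ + ρ) * d + g * (θ * ((1ℚ + ρ) * (A + b * (ι 5 * q))) + (1ℚ + ρ) * (M - M′)))
        + g * (θ * b) * ((1ℚ + ρ) * P - (S + (1ℚ + ρ) * (ι 5 * q)))
      ≡ (1ℚ + ρ) * (d * (1ℚ + ρ) + g * (θ * (A * (1ℚ + ρ) + b * P) + M))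
    identity = solve-∀ ℚ-ring
    split : ∀ d ρ g θ A b P M′ → d * ρ + g * (θ * (A * ρ + b * P) + M′)
                                 ≡ d * ρ + g * (θ * (A * ρ) + M′) + g * (θ * b) * P
    split = solve-∀ ℚ-ring
    after : ∀ {p} → IsPick R p → energy (proj₂ p) ≡ c + g * (θ * b) * Pot (proj₂ p)
    after {p} pick = trans
      (cong (λ k → d * ι k + g * (θ * (A * ι k + b * Pot (proj₂ p)) + ι (k ⊓ᴺ N₀))) (ℕₚ.suc-injective (pick-length pick)))
      (split d ρ g θ A b (Pot (proj₂ p)) M′)
    sum-after : ∑ (picks R) (λ p → energy (proj₂ p)) ≡ r * c + g * (θ * b) * S
    sum-after = trans (∑-cong-All (All-map after (picks-IsPick R)))
      (trans (∑-+ (picks R) (λ _ → c) _) (cong₂ _+_ (∑-picks-const R c) (∑-*ˡ (picks R) (g * (θ * b)) _)))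
    one : ∀ ρ → (1ℚ + ρ) ≡ (1ℚ + ρ) * (1ℚ + ρ - ρ)
    one = solve-∀ ℚ-ring
    none : ∀ x r M → x ≡ x + r * (M - M)
    none = solve-∀ ℚ-ring
    hits≤ : Δ * hits R σ τ ≤ r * d + g * (θ * (r * D R) + r * (M - M′))
    -- The minimum with N₀ loses one exactly when the current length is at most N₀; beyond that both
    -- minima equal N₀.
    hits≤ with ℕₚ.≤-<-connex (suc (length as)) N₀
    ... | inj₁ r≤N₀ = ≤-trans (hits≤few R σ τ s Δ 0≤σ σ≤1 0≤τ τ≤1 ∑σ ∑τ 0≤Δ Δs²≤1 Δ≤g 0≤D disc≤D)
      (≤-reflexive (cong (λ x → r * d + g * (θ * (r * D R) + x)) (trans (one ρ)
        (cong₂ (λ x y → r * (ι x - ι y)) (sym (ℕₚ.m≤n⇒m⊓n≡m r≤N₀)) (sym (ℕₚ.m≤n⇒m⊓n≡m (ℕₚ.<⇒≤ r≤N₀)))))))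
    ... | inj₂ N₀<r = ≤-trans (hits≤many R σ τ s Δ 0≤σ σ≤1 0≤τ τ≤1 ∑σ ∑τ 0≤Δ Δs²≤1 Δ≤g 0≤D disc≤D (ℕₚ.<⇒≤ N₀<r))
      (≤-reflexive (cong (λ x → r * d + g * x) (trans (none (θ * (r * D R)) r (ι N₀))
        (cong₂ (λ x y → θ * (r * D R) + r * (ι x - ι y)) (sym (ℕₚ.m≥n⇒m⊓n≡n (ℕₚ.<⇒≤ N₀<r))) (sym (ℕₚ.m≥n⇒m⊓n≡n (ℕₚ.≤-pred N₀<r)))))))

-- Histories, matchings and the recursion for the number of selected edges.

any-snoc : ∀ {A : Set} (p : A → Bool) xs x → any p (xs ++ [ x ]) ≡ any p xs ∨ p x
any-snoc p []       x = ∨-identityʳ (p x)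
any-snoc p (y ∷ xs) x = trans (cong (p y ∨_) (any-snoc p xs x)) (sym (∨-assoc (p y) (any p xs) (p x)))

not-∨ : ∀ b c → not (b ∨ c) ≡ not b ∧ not c
not-∨ false c = refl
not-∨ true  c = refl

none-snoc : ∀ {A : Set} (p : A → Bool) xs x → not (any p (xs ++ [ x ])) ≡ not (any p xs) ∧ not (p x)
none-snoc p xs x = trans (cong not (any-snoc p xs x)) (not-∨ (any p xs) (p x))

∧-true : ∀ {b c} → b ∧ c ≡ true → b ≡ true × c ≡ true
∧-true {true} {true} refl = refl , refl

∑-perms-1 : ∀ {A : Set} k (as : List A) → length as ≡ k → ∑ (perms as) (λ _ → 1ℚ) ≡ ι (k !ᴺ)
∑-perms-1 zero    []       refl = refl
∑-perms-1 (suc k) (a ∷ as) refl = begin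
  ∑ (perms (a ∷ as)) (λ _ → 1ℚ)
    ≡⟨ ∑-perms a as (λ _ → 1ℚ) ⟩
  ∑ (picks (a ∷ as)) (λ p → ∑ (perms (proj₂ p)) (λ _ → 1ℚ))
    ≡⟨ ∑-cong-All (All-map (λ {p} pick → ∑-perms-1 k (proj₂ p) (ℕₚ.suc-injective (pick-length pick))) (picks-IsPick (a ∷ as))) ⟩
  ∑ (picks (a ∷ as)) (λ _ → ι (k !ᴺ))
    ≡⟨ ∑-picks-const (a ∷ as) (ι (k !ᴺ)) ⟩
  ι (suc k) * ι (k !ᴺ)
    ≡⟨ sym (ι-* (suc k) (k !ᴺ)) ⟩
  ι (suc k !ᴺ) ∎
  where open ≡-Reasoning

remove : ∀ {n} → Fin n → (Fin n → Bool) → Fin n → Bool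
remove u σ w = σ w ∧ not ⌊ u ≟ᶠ w ⌋

∑-remove : ∀ {n} (u : Fin n) σ → σ u ≡ true → 1ℚ + ∑ (allFin n) (𝟙 ∘ remove u σ) ≡ ∑ (allFin n) (𝟙 ∘ σ)
∑-remove {n} u σ σu = begin
  1ℚ + ∑ (allFin n) (𝟙 ∘ remove u σ)
    ≡⟨ cong (_+ ∑ (allFin n) (𝟙 ∘ remove u σ)) (sym (trans (∑-δᶠ u (𝟙 ∘ σ)) (cong 𝟙 σu))) ⟩
  ∑ (allFin n) (λ w → δᶠ u w * 𝟙 (σ w)) + ∑ (allFin n) (𝟙 ∘ remove u σ)
    ≡⟨ sym (∑-+ (allFin n) (λ w → δᶠ u w * 𝟙 (σ w)) (𝟙 ∘ remove u σ)) ⟩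
  ∑ (allFin n) (λ w → δᶠ u w * 𝟙 (σ w) + 𝟙 (remove u σ w))
    ≡⟨ ∑-cong (allFin n) (λ w → 𝟙-split (σ w) ⌊ u ≟ᶠ w ⌋) ⟩
  ∑ (allFin n) (𝟙 ∘ σ) ∎
  where
  open ≡-Reasoning
  𝟙-split : ∀ b c → 𝟙 c * 𝟙 b + 𝟙 (b ∧ not c) ≡ 𝟙 b
  𝟙-split false false = refl
  𝟙-split false true  = refl
  𝟙-split true  false = refl
  𝟙-split true  true  = refl

module Matching (alg : RCRS) (I : Instance) where

  open Instance I
  open RCRS alg

  left : Fin m → Fin a
  left = proj₁ ∘ ends

  right : Fin m → Fin b
  right = proj₂ ∘ ends

  feasible-snoc : ∀ h g act sel f →
    feasible alg I (h ++ [ (g , act , sel) ]) f ≡ feasible alg I h f ∧ not (sel ∧ adjacent alg I g f)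
  feasible-snoc h g act sel f = none-snoc _ h (g , act , sel)

  selectedIn-snoc : ∀ h g act sel e →
    selectedIn alg I e (h ++ [ (g , act , sel) ]) ≡ selectedIn alg I e h ∨ (sel ∧ ⌊ g ≟ᶠ e ⌋)
  selectedIn-snoc h g act sel e = any-snoc _ h (g , act , sel)

  -- With no arrivals left this counts the edges already selected.
  expected : History m → List (Fin m) → ℚ
  expected h fs = ∑ (allFin m) (λ e → go alg I e h fs)

  total : History m → List (Fin m) → ℚ
  total h R = ∑ (perms R) (expected h)

  -- One arrival of `go` with the continuation abstracted. It is linear in `F`, so sums over edges
  -- and over orders pass through it.
  step : Fin m → History m → (History m → ℚ) → ℚ
  step f h F =
      x f * (effProb alg I h f * F (h ++ [ (f , true , true) ])
             + (1ℚ - effProb alg I h f) * F (h ++ [ (f , true , false) ]))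
    + (1ℚ - x f) * F (h ++ [ (f , false , false) ])

  ∑-step : ∀ {A : Set} (xs : List A) f h (F : A → History m → ℚ) →
           ∑ xs (λ y → step f h (F y)) ≡ step f h (λ h′ → ∑ xs (λ y → F y h′))
  ∑-step xs f h F = trans (∑-+ xs _ _) (cong₂ _+_
    (trans (∑-*ˡ xs (x f) _) (cong (x f *_) (trans (∑-+ xs _ _)
      (cong₂ _+_ (∑-*ˡ xs (effProb alg I h f) _) (∑-*ˡ xs (1ℚ - effProb alg I h f) _)))))
    (∑-*ˡ xs (1ℚ - x f) _))

  -- After the first arrival the order of the rest is again uniform, whatever the scheme has done.
  -- The totals are not normalised, so no factorials appear here.
  total-∷ : ∀ h e R → total h (e ∷ R) ≡ ∑ (picks (e ∷ R)) (λ p → step (proj₁ p) h (λ h′ → total h′ (proj₂ p)))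
  total-∷ h e R = trans (∑-perms e R (expected h)) (∑-cong (picks (e ∷ R)) λ p → trans
    (∑-cong (perms (proj₂ p)) (λ l → ∑-step (allFin m) (proj₁ p) h (λ e h′ → go alg I e h′ l)))
    (∑-step (perms (proj₂ p)) (proj₁ p) h (λ l h′ → expected h′ l)))

  -- σ and τ contain the vertices not yet matched, s on each side.
  record Unmatched (n : ℕ) (h : History m) (σ : Fin a → Bool) (τ : Fin b → Bool) (s : ℕ) : Set where
    field
      feasible⇒σ : ∀ f → feasible alg I h f ≡ true → σ (left f) ≡ true
      feasible⇒τ : ∀ f → feasible alg I h f ≡ true → τ (right f) ≡ true
      ∑σ≡s       : ∑ (allFin a) (𝟙 ∘ σ) ≡ ι s
      ∑τ≡s       : ∑ (allFin b) (𝟙 ∘ τ) ≡ ι s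
      selected≤  : expected h [] + ι s ≤ ι n

  open Unmatched

  skip : ∀ {n h σ τ s} f act → Unmatched n h σ τ s → Unmatched n (h ++ [ (f , act , false) ]) σ τ s
  skip {h = h} {s = s} f act U = record
    { feasible⇒σ = λ e fe → feasible⇒σ U e (before e fe)
    ; feasible⇒τ = λ e fe → feasible⇒τ U e (before e fe)
    ; ∑σ≡s       = ∑σ≡s U
    ; ∑τ≡s       = ∑τ≡s U
    ; selected≤  = ≤-trans (≤-reflexive (cong (_+ ι s) (∑-cong (allFin m) λ e →
        cong 𝟙 (trans (selectedIn-snoc h f act false e) (∨-identityʳ _))))) (selected≤ U)
    }
    where
    before : ∀ e → feasible alg I (h ++ [ (f , act , false) ]) e ≡ true → feasible alg I h e ≡ true
    before e fe = proj₁ (∧-true (trans (sym (feasible-snoc h f act false e)) fe))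

  -- Selecting f makes every edge adjacent to it infeasible, so both of its ends may leave the sets
  -- of unmatched vertices.
  take : ∀ {n h σ τ s} f → feasible alg I h f ≡ true → Unmatched n h σ τ (suc s) →
         Unmatched n (h ++ [ (f , true , true) ]) (remove (left f) σ) (remove (right f) τ) s
  take {n} {h} {σ} {τ} {s} f ff U = record
    { feasible⇒σ = λ e fe → cong₂ _∧_ (feasible⇒σ U e (proj₁ (before e fe))) (proj₁ (apart e fe))
    ; feasible⇒τ = λ e fe → cong₂ _∧_ (feasible⇒τ U e (proj₁ (before e fe))) (proj₂ (apart e fe))
    ; ∑σ≡s       = +-cancelˡ 1ℚ _ _ (trans (∑-remove (left f) σ (feasible⇒σ U f ff)) (∑σ≡s U))
    ; ∑τ≡s       = +-cancelˡ 1ℚ _ _ (trans (∑-remove (right f) τ (feasible⇒τ U f ff)) (∑τ≡s U))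
    ; selected≤  = ≤-trans (≤-trans (+-monoˡ-≤ (ι s) one-more) (≤-reflexive (+-assoc (expected h []) 1ℚ (ι s)))) (selected≤ U)
    }
    where
    before : ∀ e → feasible alg I (h ++ [ (f , true , true) ]) e ≡ true →
             feasible alg I h e ≡ true × not (adjacent alg I f e) ≡ true
    before e fe = ∧-true (trans (sym (feasible-snoc h f true true e)) fe)
    apart : ∀ e → feasible alg I (h ++ [ (f , true , true) ]) e ≡ true →
            not ⌊ left f ≟ᶠ left e ⌋ ≡ true × not ⌊ right f ≟ᶠ right e ⌋ ≡ true
    apart e fe = ∧-true (trans (sym (not-∨ ⌊ left f ≟ᶠ left e ⌋ ⌊ right f ≟ᶠ right e ⌋)) (proj₂ (before e fe)))
    𝟙-∨ : ∀ b c → 𝟙 (b ∨ c) ≤ 𝟙 b + 𝟙 c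
    𝟙-∨ false c = ≤-reflexive (sym (+-identityˡ (𝟙 c)))
    𝟙-∨ true  c = ≤-gap (𝟙 c) (0≤𝟙 c) refl
    one-more : expected (h ++ [ (f , true , true) ]) [] ≤ expected h [] + 1ℚ
    one-more = begin
      expected (h ++ [ (f , true , true) ]) []
        ≡⟨ ∑-cong (allFin m) (λ e → cong 𝟙 (selectedIn-snoc h f true true e)) ⟩
      ∑ (allFin m) (λ e → 𝟙 (selectedIn alg I e h ∨ ⌊ f ≟ᶠ e ⌋))
        ≤⟨ ∑-mono (allFin m) (λ e → 𝟙-∨ (selectedIn alg I e h) ⌊ f ≟ᶠ e ⌋) ⟩
      ∑ (allFin m) (λ e → 𝟙 (selectedIn alg I e h) + δᶠ f e)
        ≡⟨ trans (∑-+ (allFin m) _ _) (cong (expected h [] +_) (∑-δᶠ-1 f)) ⟩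
      expected h [] + 1ℚ ∎
      where open ≤-Reasoning

  -- The left end of a feasible edge is itself unmatched. Hence a selection never occurs at the
  -- truncated value of `jump`.
  feasible⇒s>0 : ∀ {n h σ τ s} f → feasible alg I h f ≡ true → Unmatched n h σ τ s → ∃ λ s′ → s ≡ suc s′
  feasible⇒s>0 {σ = σ} {s = suc s} f ff U = s , refl
  feasible⇒s>0 {σ = σ} {s = zero}  f ff U = ⊥-elim (<-irrefl refl (begin-strict
    0ℚ                                              <⟨ 0<ι 1 ⟩
    1ℚ                                              ≤⟨ ≤-gap _ (0≤∑ (allFin a) (λ w → 0≤𝟙 (remove (left f) σ w))) refl ⟩
    1ℚ + ∑ (allFin a) (𝟙 ∘ remove (left f) σ)       ≡⟨ trans (∑-remove (left f) σ (feasible⇒σ U f ff)) (∑σ≡s U) ⟩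
    0ℚ                                              ∎))
    where open ≤-Reasoning

-- Growth of 1/(s + K) at a selection.

-- Zero at s = 0, where pred truncates.
jump : ℕ → ℕ → ℚ
jump K s = recip (ℕ.pred s +ᴺ K) - recip (s +ᴺ K)

recip-suc : ∀ k → .{{ℕ.NonZero k}} → recip k - recip (suc k) ≡ recip k * recip (suc k)
recip-suc k = begin
  recip k - recip (suc k)
    ≡⟨ sym (cong₂ _-_ (trans (cong (recip k *_) (ι*recip (suc k))) (*-identityʳ (recip k)))
                      (trans (cong (_* recip (suc k)) (ι*recip k)) (*-identityˡ (recip (suc k))))) ⟩
  recip k * (ι (suc k) * recip (suc k)) - ι k * recip k * recip (suc k)
    ≡⟨ identity (ι k) (recip k) (recip (suc k)) ⟩
  recip k * recip (suc k) ∎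
  where
  open ≡-Reasoning
  identity : ∀ k x y → x * ((1ℚ + k) * y) - k * x * y ≡ x * y
  identity = solve-∀ ℚ-ring

module _ (K : ℕ) .{{K≢0 : ℕ.NonZero K}} where

  s+K≢0 : ∀ s → ℕ.NonZero (s +ᴺ K)
  s+K≢0 zero    = ℕ.≢-nonZero (ℕ.≢-nonZero⁻¹ K)
  s+K≢0 (suc s) = _

  jump-zero : jump K 0 ≡ 0ℚ
  jump-zero = +-inverseʳ (recip K)

  jump-suc : ∀ s → jump K (suc s) ≡ recip (s +ᴺ K) * recip (suc s +ᴺ K)
  jump-suc s = recip-suc (s +ᴺ K) {{s+K≢0 s}}

  0≤jump : ∀ s → 0ℚ ≤ jump K s
  0≤jump zero    = ≤-reflexive (sym jump-zero)
  0≤jump (suc s) = ≤-trans (0≤-* (0≤recip (s +ᴺ K)) (0≤recip (suc s +ᴺ K))) (≤-reflexive (sym (jump-suc s)))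

  -- The purpose of the shift by K: jumps stay bounded even when few vertices are unmatched, so
  -- errors in the hit count are multiplied by at most 1/K².
  jump≤ : ∀ s → jump K s ≤ recip K * recip K
  jump≤ zero    = ≤-trans (≤-reflexive jump-zero) (0≤-* (0≤recip K) (0≤recip K))
  jump≤ (suc s) = ≤-trans (≤-reflexive (jump-suc s))
    (*-mono (0≤recip (suc s +ᴺ K)) (0≤recip K) (recip-antimono (ℕₚ.m≤n+m K s)) (recip-antimono (ℕₚ.m≤n+m K (suc s))))

  -- Since K ≥ 1, both s + K and s + 1 + K are at least s + 1. This cancels the factor s² in the
  -- number of evenly spread hits.
  jump*s²≤1 : ∀ s → jump K s * (ι s * ι s) ≤ 1ℚ
  jump*s²≤1 zero    = ≤-trans (≤-reflexive (*-zeroʳ (jump K 0))) (0≤ι 1)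
  jump*s²≤1 (suc s) = begin
    jump K (suc s) * (ι (suc s) * ι (suc s))
      ≡⟨ cong (_* (ι (suc s) * ι (suc s))) (jump-suc s) ⟩
    recip (s +ᴺ K) * recip (suc s +ᴺ K) * (ι (suc s) * ι (suc s))
      ≡⟨ identity (recip (s +ᴺ K)) (recip (suc s +ᴺ K)) (ι (suc s)) ⟩
    ι (suc s) * recip (s +ᴺ K) * (ι (suc s) * recip (suc s +ᴺ K))
      ≤⟨ *-mono (0≤-* (0≤ι (suc s)) (0≤recip (suc s +ᴺ K))) (0≤ι 1)
           (ratio≤1 (s +ᴺ K) {{s+K≢0 s}} (ℕₚ.≤-trans (ℕₚ.≤-reflexive (ℕₚ.+-comm 1 s)) (ℕₚ.+-monoʳ-≤ s (ℕ.>-nonZero⁻¹ K))))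
           (ratio≤1 (suc s +ᴺ K) (ℕₚ.m≤m+n (suc s) K)) ⟩
    1ℚ * 1ℚ
      ≡⟨ *-identityʳ 1ℚ ⟩
    1ℚ ∎
    where
    open ≤-Reasoning
    identity : ∀ x y s → x * y * (s * s) ≡ s * x * (s * y)
    identity = solve-∀ ℚ-ring
    ratio≤1 : ∀ k → .{{ℕ.NonZero k}} → suc s ≤ᴺ k → ι (suc s) * recip k ≤ 1ℚ
    ratio≤1 k s<k = ≤-trans (*-monoʳ (0≤recip k) (ι-mono s<k)) (≤-reflexive (ι*recip k))

-- The complete bipartite graph with weights 1/n.

module _ (n : ℕ) .{{n≢0 : ℕ.NonZero n}} where

  private
    ∑-fibre : ∑ (allFin n) (λ _ → recip n) ≡ 1ℚ
    ∑-fibre = trans (∑-const (allFin n) (recip n))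
      (trans (cong (λ k → ι k * recip n) (length-tabulate {n = n} id)) (ι*recip n))

    ∑-δᶠ-fst : ∀ u → ∑ (allFin n) (λ u′ → ∑ (allFin n) (λ _ → δᶠ u′ u * recip n)) ≡ 1ℚ
    ∑-δᶠ-fst u = trans
      (∑-cong (allFin n) (λ u′ → trans (∑-*ˡ (allFin n) (δᶠ u′ u) (λ _ → recip n)) (cong₂ _*_ (δᶠ-sym u′ u) ∑-fibre)))
      (∑-δᶠ u (λ _ → 1ℚ))

  complete : Instance
  complete = record
    { a         = n
    ; b         = n
    ; m         = n *ᴺ n
    ; ends      = remQuot {n} n
    ; simple    = λ e f eq → trans (sym (Finₚ.combine-remQuot {n} n e))
                    (trans (cong (λ p → combine (proj₁ p) (proj₂ p)) eq) (Finₚ.combine-remQuot {n} n f))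
    ; x         = λ _ → recip n
    ; x≥0       = λ _ → 0≤recip n
    ; x≤1       = λ _ → recip-antimono (ℕ.>-nonZero⁻¹ n)
    ; leftLoad  = λ u → ≤-reflexive (trans (∑-filter (proj₁ ∘ remQuot {n} n) u (allFin (n *ᴺ n)) (λ _ → recip n))
                    (trans (∑-remQuot n n (λ p → δᶠ (proj₁ p) u * recip n)) (∑-δᶠ-fst u)))
    ; rightLoad = λ v → ≤-reflexive (trans (∑-filter (proj₂ ∘ remQuot {n} n) v (allFin (n *ᴺ n)) (λ _ → recip n))
                    (trans (∑-remQuot n n (λ p → δᶠ (proj₂ p) v * recip n))
                      (trans (∑-comm (allFin n) (allFin n) _) (∑-δᶠ-fst v))))
    }

-- The supersolution of the selection recursion.

mix-skip≤ : ∀ {w t t₁ t₂ t₃} → 0ℚ ≤ w → w ≤ 1ℚ → t₂ ≤ t → t₃ ≤ t →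
            w * (0ℚ * t₁ + (1ℚ - 0ℚ) * t₂) + (1ℚ - w) * t₃ ≤ t
mix-skip≤ {w} {t} {t₁} {t₂} {t₃} 0≤w w≤1 t₂≤ t₃≤ = begin
  w * (0ℚ * t₁ + (1ℚ - 0ℚ) * t₂) + (1ℚ - w) * t₃   ≡⟨ before w t₁ t₂ t₃ ⟩
  w * t₂ + (1ℚ - w) * t₃                           ≤⟨ +-mono-≤ (*-monoˡ 0≤w t₂≤) (*-monoˡ (≤⇒0≤- w≤1) t₃≤) ⟩
  w * t + (1ℚ - w) * t                             ≡⟨ after w t ⟩
  t                                                ∎
  where
  open ≤-Reasoning
  before : ∀ w t₁ t₂ t₃ → w * (0ℚ * t₁ + (1ℚ - 0ℚ) * t₂) + (1ℚ - w) * t₃ ≡ w * t₂ + (1ℚ - w) * t₃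
  before = solve-∀ ℚ-ring
  after : ∀ w t → w * t + (1ℚ - w) * t ≡ t
  after = solve-∀ ℚ-ring

-- The scheme's choice p disappears here: as y ≥ 0, the bound is largest when every feasible active
-- edge is accepted.
mix-take≤ : ∀ {w p t y t₁ t₂ t₃} → 0ℚ ≤ w → w ≤ 1ℚ → 0ℚ ≤ p → p ≤ 1ℚ → 0ℚ ≤ y → t₁ ≤ t + y → t₂ ≤ t → t₃ ≤ t →
            w * (p * t₁ + (1ℚ - p) * t₂) + (1ℚ - w) * t₃ ≤ t + w * y
mix-take≤ {w} {p} {t} {y} {t₁} {t₂} {t₃} 0≤w w≤1 0≤p p≤1 0≤y t₁≤ t₂≤ t₃≤ = begin
  w * (p * t₁ + (1ℚ - p) * t₂) + (1ℚ - w) * t₃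
    ≤⟨ +-mono-≤ (*-monoˡ 0≤w (+-mono-≤ (*-monoˡ 0≤p t₁≤) (*-monoˡ (≤⇒0≤- p≤1) t₂≤))) (*-monoˡ (≤⇒0≤- w≤1) t₃≤) ⟩
  w * (p * (t + y) + (1ℚ - p) * t) + (1ℚ - w) * t
    ≤⟨ ≤-gap (w * (1ℚ - p) * y) (0≤-* (0≤-* 0≤w (≤⇒0≤- p≤1)) 0≤y) (identity w p t y) ⟩
  t + w * y ∎
  where
  open ≤-Reasoning
  identity : ∀ w p t y → w * (p * (t + y) + (1ℚ - p) * t) + (1ℚ - w) * t + w * (1ℚ - p) * y ≡ t + w * y
  identity = solve-∀ ℚ-ring

module Complete (alg : RCRS) (n K N₀ : ℕ) .{{n≢0 : ℕ.NonZero n}} .{{K≢0 : ℕ.NonZero K}} .{{N₀≢0 : ℕ.NonZero N₀}}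
  (A b : ℚ) (0≤b : 0ℚ ≤ b)
  where

  E : Set
  E = Fin (n *ᴺ n)

  ends : E → Fin n × Fin n
  ends = remQuot {n} n

  g θ : ℚ
  g = recip K * recip K
  θ = recip N₀

  open Energy ends A b g θ N₀ 0≤b (0≤-* (0≤recip K) (0≤recip K)) (0≤recip N₀)
    (trans (*-comm (recip N₀) (ι N₀)) (ι*recip N₀)) public
  open Matching alg (complete n) public
  open Unmatched
  open RCRS alg using (prob; prob≥0; prob≤1)

  -- Linearising 1 / (s + K) at the end of the process bounds the number n - s of selected edges.
  module Supersolution (c₀ Y : ℚ) (0≤Y : 0ℚ ≤ Y)
    (tangent : ∀ s → ι n - ι s ≤ c₀ + Y * recip (s +ᴺ K))
    (disc≤D : ∀ R σ τ → (∀ u → σ u * σ u ≤ 1ℚ) → (∀ v → τ v * τ v ≤ 1ℚ) → disc R σ τ ≤ D R)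
    where

    w : ℚ
    w = recip n

    -- The term `w * energy R` bounds the expected growth of 1/(s + K) while the edges of R arrive;
    -- w is the probability that an arriving edge is active.
    Ψ : ℕ → List E → ℚ
    Ψ s R = c₀ + Y * (recip (s +ᴺ K) + w * energy R)

    -- Lets `Ψ` dominate the tangent bound at the end of the process. All entries of `ξ` vanish on
    -- the empty list, so `pot` does too.
    0≤energy[] : 0ℚ ≤ energy []
    0≤energy[] = ≤-gap _ (0≤-* (0≤-* (0≤-* (0≤recip K) (0≤recip K)) (0≤recip N₀)) (0≤-* 0≤b 0≤Pot[]))
      (identity d g θ A b (Pot []))
      where
      identity : ∀ d g θ A b P → 0ℚ + g * θ * (b * P) ≡ d * 0ℚ + g * (θ * (A * 0ℚ + b * P) + 0ℚ)
      identity = solve-∀ ℚ-ring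
      vanish : ∀ d → 0ℚ ≡ (1ℚ + 0ℚ) * ((0ℚ - 0ℚ * d) * (0ℚ - 0ℚ * d) * ((0ℚ - 0ℚ * d) * (0ℚ - 0ℚ * d))) + ι 60 * d * 0ℚ
      vanish = solve-∀ ℚ-ring
      0≤pot[] : ∀ t → 0ℚ ≤ pot [] t
      0≤pot[] t with degenerate t
      ... | true  = ≤-reflexive (sym (*-zeroʳ (ι 5)))
      ... | false = ≤-reflexive (vanish d)
      0≤Pot[] : 0ℚ ≤ Pot []
      0≤Pot[] = 0≤∑ cycles 0≤pot[]

    -- Zero weights have discrepancy zero, and `D R` bounds the discrepancy of all weights.
    0≤D : ∀ R → 0ℚ ≤ D R
    0≤D R = ≤-trans (≤-reflexive (sym zero-disc)) (disc≤D R (λ _ → 0ℚ) (λ _ → 0ℚ) (λ _ → 0≤ι 1) (λ _ → 0≤ι 1))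
      where
      X₀ : Fin n → ℚ
      X₀ u = ∑ V (λ v → 0ℚ * ξ R u v)
      zero-disc : disc R (λ _ → 0ℚ) (λ _ → 0ℚ) ≡ 0ℚ
      zero-disc = trans (∑-*ˡ V 0ℚ X₀) (*-zeroˡ (∑ V X₀))

    𝟙² : ∀ c → 𝟙 c * 𝟙 c ≤ 1ℚ
    𝟙² c = *-mono (0≤𝟙 c) (0≤ι 1) (𝟙≤1 c) (𝟙≤1 c)

    -- A selected edge raises Ψ by Y * jump K s.
    step≤ : ∀ {h σ τ s k} R′ f → Unmatched n h σ τ s → 0ℚ ≤ k →
      (∀ {h σ τ s} → Unmatched n h σ τ s → total h R′ ≤ k * Ψ s R′) →
      step f h (λ h′ → total h′ R′)
      ≤ k * (Ψ s R′ + w * Y * (jump K s * (𝟙 (σ (left f)) * 𝟙 (τ (right f)))))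
    step≤ {h} {σ} {τ} {s} {k} R′ f U 0≤k bound = by-feasible (feasible alg (complete n) h f) refl
      where
      w≤1 : w ≤ 1ℚ
      w≤1 = recip-antimono (ℕ.>-nonZero⁻¹ n)
      Claim : ℕ → ℚ → Set
      Claim s p =
        w * (p * total (h ++ [ (f , true , true) ]) R′ + (1ℚ - p) * total (h ++ [ (f , true , false) ]) R′)
          + (1ℚ - w) * total (h ++ [ (f , false , false) ]) R′
        ≤ k * (Ψ s R′ + w * Y * (jump K s * (𝟙 (σ (left f)) * 𝟙 (τ (right f)))))
      infeasible : Claim s 0ℚ
      infeasible = ≤-trans
        (mix-skip≤ {t₁ = total (h ++ [ (f , true , true) ]) R′} (0≤recip n) w≤1 (bound (skip f true U)) (bound (skip f false U)))
        (*-monoˡ 0≤k (≤-gap _ (0≤-* (0≤-* (0≤recip n) 0≤Y)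
          (0≤-* (0≤jump K s) (0≤-* (0≤𝟙 (σ (left f))) (0≤𝟙 (τ (right f)))))) refl))
      by-suc : ∀ {s} → feasible alg (complete n) h f ≡ true → Unmatched n h σ τ (suc s) →
               Claim (suc s) (prob (complete n) h f)
      by-suc {s} ff U = ≤-trans
        (mix-take≤ {y = k * (Y * jump K (suc s))} (0≤recip n) w≤1 (prob≥0 (complete n) h f) (prob≤1 (complete n) h f)
          (0≤-* 0≤k (0≤-* 0≤Y (0≤jump K (suc s))))
          (≤-trans (bound (take f ff U)) (≤-reflexive (lower k c₀ Y (recip (s +ᴺ K)) (recip (suc s +ᴺ K)) (w * energy R′))))
          (bound (skip f true U)) (bound (skip f false U)))
        (≤-reflexive (trans (collect k (Ψ (suc s) R′) w Y (jump K (suc s)))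
          (cong₂ (λ b c → k * (Ψ (suc s) R′ + w * Y * (jump K (suc s) * (𝟙 b * 𝟙 c))))
            (sym (feasible⇒σ U f ff)) (sym (feasible⇒τ U f ff)))))
        where
        lower : ∀ k c Y x′ x e → k * (c + Y * (x′ + e)) ≡ k * (c + Y * (x + e)) + k * (Y * (x′ - x))
        lower = solve-∀ ℚ-ring
        collect : ∀ k ψ w Y j → k * ψ + w * (k * (Y * j)) ≡ k * (ψ + w * Y * (j * (1ℚ * 1ℚ)))
        collect = solve-∀ ℚ-ring
      by-feasible : ∀ c → feasible alg (complete n) h f ≡ c → Claim s (if c then prob (complete n) h f else 0ℚ)
      by-feasible false _  = infeasible
      by-feasible true  ff with s′ , refl ← feasible⇒s>0 f ff U = by-suc ff U

    ∑-Ψ : ∀ R s j (hit : E → ℚ) → ∑ (picks R) (λ p → Ψ s (proj₂ p) + w * Y * (j * hit (proj₁ p)))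
      ≡ ι (length R) * (c₀ + Y * recip (s +ᴺ K)) + Y * w * (∑ (picks R) (λ p → energy (proj₂ p)) + j * ∑ R hit)
    ∑-Ψ R s j hit = trans
      (∑-cong (picks R) (λ p → split c₀ Y (recip (s +ᴺ K)) w (energy (proj₂ p)) (j * hit (proj₁ p))))
      (trans (∑-+ (picks R) (λ _ → c₀ + Y * recip (s +ᴺ K)) _) (cong₂ _+_ (∑-picks-const R (c₀ + Y * recip (s +ᴺ K)))
        (trans (∑-*ˡ (picks R) (Y * w) _) (cong (Y * w *_) (trans (∑-+ (picks R) _ _)
          (cong (∑ (picks R) (λ p → energy (proj₂ p)) +_) (trans (∑-*ˡ (picks R) j _) (cong (j *_) (∑-picks R hit)))))))))
      where
      split : ∀ c Y x w e j → c + Y * (x + w * e) + w * Y * j ≡ c + Y * x + Y * w * (e + j)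
      split = solve-∀ ℚ-ring

    -- Induction on the number of remaining edges: `step≤` bounds the gain from the next edge, and
    -- `energy-drift` pays for its average. The claim covers every history, so adaptive choices of
    -- the unmatched sets are included; k! is the number of orders in `total`.
    total≤ : ∀ k R → length R ≡ k → Simple R → ∀ {h σ τ s} → Unmatched n h σ τ s →
             total h R ≤ ι (k !ᴺ) * Ψ s R
    total≤ zero [] refl simple {h} {s = s} U = begin
      expected h [] + 0ℚ
        ≤⟨ ≤-gap _ (≤⇒0≤- (selected≤ U)) (isolate (expected h []) (ι s) (ι n)) ⟩
      ι n - ι s
        ≤⟨ tangent s ⟩
      c₀ + Y * recip (s +ᴺ K)
        ≤⟨ ≤-gap _ (0≤-* 0≤Y (0≤-* (0≤recip n) 0≤energy[])) (collect c₀ Y (recip (s +ᴺ K)) w (energy [])) ⟩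
      ι (0 !ᴺ) * Ψ s [] ∎
      where
      open ≤-Reasoning
      isolate : ∀ e s n → e + 0ℚ + (n - (e + s)) ≡ n - s
      isolate = solve-∀ ℚ-ring
      collect : ∀ c Y x w e → c + Y * x + Y * (w * e) ≡ (1ℚ + 0ℚ) * (c + Y * (x + w * e))
      collect = solve-∀ ℚ-ring
    total≤ (suc k) R@(e ∷ es) refl simple {h} {σ} {τ} {s} U = begin
      total h R
        ≡⟨ total-∷ h e es ⟩
      ∑ (picks R) (λ p → step (proj₁ p) h (λ h′ → total h′ (proj₂ p)))
        ≤⟨ ∑-mono-All (All-map (λ {p} pick → step≤ (proj₂ p) (proj₁ p) U (0≤ι (k !ᴺ))
             (total≤ k (proj₂ p) (ℕₚ.suc-injective (pick-length pick)) (Simple-pick simple pick))) (picks-IsPick R)) ⟩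
      ∑ (picks R) (λ p → ι (k !ᴺ) * (Ψ s (proj₂ p) + w * Y * (jump K s * hit (proj₁ p))))
        ≡⟨ trans (∑-*ˡ (picks R) (ι (k !ᴺ)) _) (cong (ι (k !ᴺ) *_) (∑-Ψ R s (jump K s) hit)) ⟩
      ι (k !ᴺ) * (r * (c₀ + Y * recip (s +ᴺ K)) + Y * w * (∑ (picks R) (λ p → energy (proj₂ p)) + jump K s * hits R (𝟙 ∘ σ) (𝟙 ∘ τ)))
        ≤⟨ *-monoˡ (0≤ι (k !ᴺ)) (+-monoʳ-≤ (r * (c₀ + Y * recip (s +ᴺ K))) (*-monoˡ (0≤-* 0≤Y (0≤recip n))
             (energy-drift simple (𝟙 ∘ σ) (𝟙 ∘ τ) (ι s) (jump K s) (λ u → 0≤𝟙 (σ u)) (λ u → 𝟙≤1 (σ u)) (λ v → 0≤𝟙 (τ v)) (λ v → 𝟙≤1 (τ v))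
               (∑σ≡s U) (∑τ≡s U) (0≤jump K s) (jump*s²≤1 K s) (jump≤ K s) (0≤D R)
               (disc≤D R (𝟙 ∘ σ) (𝟙 ∘ τ) (λ u → 𝟙² (σ u)) (λ v → 𝟙² (τ v)))))) ⟩
      ι (k !ᴺ) * (r * (c₀ + Y * recip (s +ᴺ K)) + Y * w * (r * energy R))
        ≡⟨ trans (collect (ι (k !ᴺ)) r c₀ Y (recip (s +ᴺ K)) w (energy R)) (cong (_* Ψ s R) (sym (ι-* (suc k) (k !ᴺ)))) ⟩
      ι (suc k !ᴺ) * Ψ s R ∎
      where
      open ≤-Reasoning
      r = ι (suc k)
      hit : E → ℚ
      hit f = 𝟙 (σ (left f)) * 𝟙 (τ (right f))
      collect : ∀ k r c Y x w e → k * (r * (c + Y * x) + Y * w * (r * e)) ≡ r * k * (c + Y * (x + w * e))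
      collect = solve-∀ ℚ-ring

-- Initial values on the complete bipartite graph.

module CompleteStart (alg : RCRS) (n K N₀ : ℕ) .{{n≢0 : ℕ.NonZero n}} .{{K≢0 : ℕ.NonZero K}} .{{N₀≢0 : ℕ.NonZero N₀}}
  (A b : ℚ) (0≤b : 0ℚ ≤ b)
  where

  open Complete alg n K N₀ A b 0≤b public

  all : List E
  all = allFin (n *ᴺ n)

  length-all : length all ≡ n *ᴺ n
  length-all = length-tabulate id

  n²≢0 : ℕ.NonZero (n *ᴺ n)
  n²≢0 = ℕₚ.m*n≢0 n n

  η-all : ∀ u v → η all u v ≡ 1ℚ
  η-all u v = begin
    η all u v
      ≡⟨ ∑-remQuot n n (λ p → δᶠ (proj₁ p) u * δᶠ (proj₂ p) v) ⟩
    ∑ V (λ u′ → ∑ V (λ v′ → δᶠ u′ u * δᶠ v′ v))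
      ≡⟨ sym (∑-product V V (λ u′ → δᶠ u′ u) (λ v′ → δᶠ v′ v)) ⟩
    ∑ V (λ u′ → δᶠ u′ u) * ∑ V (λ v′ → δᶠ v′ v)
      ≡⟨ cong₂ _*_ (trans (∑-cong V (λ u′ → δᶠ-sym u′ u)) (∑-δᶠ-1 u)) (trans (∑-cong V (λ v′ → δᶠ-sym v′ v)) (∑-δᶠ-1 v)) ⟩
    1ℚ * 1ℚ
      ≡⟨ *-identityʳ 1ℚ ⟩
    1ℚ ∎
    where open ≡-Reasoning

  Simple-all : Simple all
  Simple-all = record
    { η≤1      = λ u v → ≤-reflexive (η-all u v)
    ; length≤  = ℕₚ.≤-reflexive length-all
    ; nonempty = n²≢0
    }

  ι*d≡1 : ι (length all) * d ≡ 1ℚ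
  ι*d≡1 = trans (cong (λ k → ι k * d) length-all) (ι*recip (n *ᴺ n) {{n²≢0}})

  -- Every pair is joined by exactly one edge, so the process starts perfectly even and the initial
  -- potential consists of error terms only.
  ξ-all : ∀ u v → ξ all u v ≡ 0ℚ
  ξ-all u v = trans (cong₂ _-_ (η-all u v) ι*d≡1) (+-inverseʳ 1ℚ)

  Z-all : ∀ t → Z all t ≡ 0ℚ
  Z-all ((u , u′) , (v , v′)) = trans (cong (λ x → x * ξ all u v′ * (ξ all u′ v * ξ all u′ v′)) (ξ-all u v))
    (vanish (ξ all u v′) (ξ all u′ v * ξ all u′ v′))
    where
    vanish : ∀ x y → 0ℚ * x * y ≡ 0ℚ
    vanish = solve-∀ ℚ-ring

  N : ℚ
  N = ι n * ι n

  ι-length-all : ι (length all) ≡ N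
  ι-length-all = trans (cong ι length-all) (ι-* n n)

  -- A nondegenerate walk has Z = 0 and r d = 1, which leaves 60; a degenerate one contributes 5 n²,
  -- charged to a coincidence of left or of right vertices.
  pot-all : ∀ u u′ v v′ → pot all ((u , u′) , (v , v′)) ≤ ι 60 + ι 5 * N * (δᶠ u u′ + δᶠ v v′)
  pot-all u u′ v v′ = ≤-trans
    (cases ⌊ u ≟ᶠ u′ ⌋ ⌊ v ≟ᶠ v′ ⌋ (ι (length all)) (Z all ((u , u′) , (v , v′))) d (0≤ι (length all)) (Z-all ((u , u′) , (v , v′))) ι*d≡1)
    (≤-reflexive (cong (λ x → ι 60 + ι 5 * x * (δᶠ u u′ + δᶠ v v′)) ι-length-all))
    where
    cases : ∀ c c′ r z d → 0ℚ ≤ r → z ≡ 0ℚ → r * d ≡ 1ℚ →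
      (if c ∨ c′ then ι 5 * r else (1ℚ + r) * z + ι 60 * d * r) ≤ ι 60 + ι 5 * r * (𝟙 c + 𝟙 c′)
    cases false false r z d 0≤r refl rd≡1 = ≤-reflexive (trans (regroup r d) (trans (cong (ι 60 *_) rd≡1) (one r)))
      where
      regroup : ∀ r d → (1ℚ + r) * 0ℚ + ι 60 * d * r ≡ ι 60 * (r * d)
      regroup = solve-∀ ℚ-ring
      one : ∀ r → ι 60 * 1ℚ ≡ ι 60 + ι 5 * r * (0ℚ + 0ℚ)
      one = solve-∀ ℚ-ring
    cases false true  r z d 0≤r _ _ = ≤-gap (ι 60) (0≤ι 60) (identity r)
      where
      identity : ∀ r → ι 5 * r + ι 60 ≡ ι 60 + ι 5 * r * (0ℚ + 1ℚ)
      identity = solve-∀ ℚ-ring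
    cases true  false r z d 0≤r _ _ = ≤-gap (ι 60) (0≤ι 60) (identity r)
      where
      identity : ∀ r → ι 5 * r + ι 60 ≡ ι 60 + ι 5 * r * (1ℚ + 0ℚ)
      identity = solve-∀ ℚ-ring
    cases true  true  r z d 0≤r _ _ = ≤-gap (ι 60 + ι 5 * r) (0≤-+ (0≤ι 60) (0≤-* (0≤ι 5) 0≤r)) (identity r)
      where
      identity : ∀ r → ι 5 * r + (ι 60 + ι 5 * r) ≡ ι 60 + ι 5 * r * (1ℚ + 1ℚ)
      identity = solve-∀ ℚ-ring

  -- There are n⁴ walks at 60 each, and each of the two kinds of coincidence occurs in n³ walks at 5
  -- n²: in total 60 n⁴ + 10 n⁵ ≤ 70 n⁵.
  Pot-all : Pot all ≤ ι 70 * (N * N * ι n)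
  Pot-all = begin
    Pot all
      ≡⟨ trans (∑-× V² V² (pot all)) (trans (∑-× V V _) (∑-cong V (λ u → ∑-cong V (λ u′ → ∑-× V V _)))) ⟩
    ∑ V (λ u → ∑ V (λ u′ → ∑ V (λ v → ∑ V (λ v′ → pot all ((u , u′) , (v , v′))))))
      ≤⟨ ∑-mono V (λ u → ∑-mono V (λ u′ → ∑-mono V (λ v → ∑-mono V (λ v′ → pot-all u u′ v v′)))) ⟩
    ∑ V (λ u → ∑ V (λ u′ → ∑ V (λ v → ∑ V (λ v′ → ι 60 + ι 5 * N * (δᶠ u u′ + δᶠ v v′)))))
      ≡⟨ ∑-cong V (λ u → ∑-cong V (λ u′ → ∑-cong V (λ v → inner (δᶠ u u′) v))) ⟩
    ∑ V (λ u → ∑ V (λ u′ → ∑ V (λ _ → ι n * ι 60 + ι 5 * N * (ι n * δᶠ u u′ + 1ℚ))))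
      ≡⟨ ∑-cong V (λ u → trans (∑-cong V (λ u′ → trans (∑V-const _) (regroup (ι n) N (δᶠ u u′))))
           (trans (∑-+ V _ _) (cong₂ _+_ (∑V-const _) (trans (∑-*ˡ V (ι 5 * N * (ι n * ι n)) (δᶠ u)) (cong (ι 5 * N * (ι n * ι n) *_) (∑-δᶠ-1 u)))))) ⟩
    ∑ V (λ _ → ι n * (ι n * (ι n * ι 60) + ι 5 * N * ι n) + ι 5 * N * (ι n * ι n) * 1ℚ)
      ≡⟨ ∑V-const _ ⟩
    ι n * (ι n * (ι n * (ι n * ι 60) + ι 5 * N * ι n) + ι 5 * N * (ι n * ι n) * 1ℚ)
      ≤⟨ ≤-gap (ι 60 * (N * N) * (ι n - 1ℚ)) (0≤-* (0≤-* (0≤ι 60) (0≤x² N)) (≤⇒0≤- (ι-mono (ℕ.>-nonZero⁻¹ n)))) (identity (ι n)) ⟩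
    ι 70 * (N * N * ι n) ∎
    where
    open ≤-Reasoning
    V² = cartesianProduct V V
    inner : ∀ x v → ∑ V (λ v′ → ι 60 + ι 5 * N * (x + δᶠ v v′)) ≡ ι n * ι 60 + ι 5 * N * (ι n * x + 1ℚ)
    inner x v = trans (∑-+ V (λ _ → ι 60) _) (cong₂ _+_ (∑V-const (ι 60)) (trans (∑-*ˡ V (ι 5 * N) _)
      (cong (ι 5 * N *_) (trans (∑-+ V (λ _ → x) (δᶠ v)) (cong₂ _+_ (∑V-const x) (∑-δᶠ-1 v))))))
    regroup : ∀ n N x → n * (n * ι 60 + ι 5 * N * (n * x + 1ℚ)) ≡ n * (n * ι 60) + ι 5 * N * n + ι 5 * N * (n * n) * x
    regroup = solve-∀ ℚ-ring
    identity : ∀ n →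
      n * (n * (n * (n * ι 60) + ι 5 * (n * n) * n) + ι 5 * (n * n) * (n * n) * 1ℚ) + ι 60 * (n * n * (n * n)) * (n - 1ℚ)
      ≡ ι 70 * (n * n * (n * n) * n)
    identity = solve-∀ ℚ-ring

  start : Unmatched n [] (λ _ → true) (λ _ → true) n
  start = record
    { feasible⇒σ = λ _ _ → refl
    ; feasible⇒τ = λ _ _ → refl
    ; ∑σ≡s       = trans (∑V-const 1ℚ) (*-identityʳ (ι n))
    ; ∑τ≡s       = trans (∑V-const 1ℚ) (*-identityʳ (ι n))
    ; selected≤  = ≤-reflexive (trans (cong (_+ ι n) (trans (∑-const all 0ℚ) (*-zeroʳ (ι (length all))))) (+-identityˡ (ι n)))
    }

  -- Summed over the n² edges of weight 1/n, selectability demands c n selected edges on average,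
  -- here multiplied by the (n²)! orders.
  selectable⇒ : ∀ c → SelectableOnBipartite alg c → c * ι n * ι ((n *ᴺ n) !ᴺ) ≤ total [] all
  selectable⇒ c selectable = begin
    c * ι n * ι ((n *ᴺ n) !ᴺ)
      ≡⟨ sym lhs ⟩
    ∑ all (λ _ → c * recip n * ((ℤ.+ length (perms all)) / 1))
      ≤⟨ ∑-mono all (selectable (complete n)) ⟩
    ∑ all (λ e → ∑ (perms all) (go alg (complete n) e []))
      ≡⟨ ∑-comm all (perms all) (λ e l → go alg (complete n) e [] l) ⟩
    total [] all ∎
    where
    open ≤-Reasoning
    orders≡ : (ℤ.+ length (perms all)) / 1 ≡ ι ((n *ᴺ n) !ᴺ)
    orders≡ = trans (+k/1≡ιk (length (perms all))) (trans (sym (*-identityʳ _))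
      (trans (sym (∑-const (perms all) 1ℚ)) (∑-perms-1 (n *ᴺ n) all length-all)))
    regroup : ∀ n w c k → n * n * (c * w * k) ≡ c * n * k * (n * w)
    regroup = solve-∀ ℚ-ring
    lhs : ∑ all (λ _ → c * recip n * ((ℤ.+ length (perms all)) / 1)) ≡ c * ι n * ι ((n *ᴺ n) !ᴺ)
    lhs = trans (∑-const all _) (trans (cong₂ (λ x y → x * (c * recip n * y)) ι-length-all orders≡)
      (trans (regroup (ι n) (recip n) c (ι ((n *ᴺ n) !ᴺ))) (trans (cong (c * ι n * ι ((n *ᴺ n) !ᴺ) *_) (ι*recip n)) (*-identityʳ _))))

-- Choice of parameters.

-- With n = 70 J²⁴, K = n/J, N₀ = n²/J³ and L = J⁶, the discrepancy, the last N₀ edges and the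
-- shift K each cost O(1/J) relative to n.
module Parameters (alg : RCRS) (J L M K n N₀ : ℕ)
  .{{J≢0 : ℕ.NonZero J}} .{{L≢0 : ℕ.NonZero L}} .{{K≢0 : ℕ.NonZero K}} .{{n≢0 : ℕ.NonZero n}} .{{N₀≢0 : ℕ.NonZero N₀}}
  (L≡ : ι L ≡ ι J * ι J * ι J * (ι J * ι J * ι J)) (K≡ : ι K ≡ ι J * ι J * ι M)
  (n≡ : ι n ≡ ι J * ι K) (N₀≡ : ι N₀ ≡ ι n * ι M) (n≡70L⁴ : ι n ≡ ι 70 * (ι L * ι L * (ι L * ι L)))
  where

  private
    ν w ℓ z A b : ℚ
    ν = ι n
    w = recip n
    ℓ = ι L
    z = recip L
    -- A = n²/L and b = L³/n² come from `disc≤` at l = n/L and k = n/L².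
    A = ν * ν * z
    b = w * w * (ℓ * ℓ * ℓ)

    νw≡1 : ν * w ≡ 1ℚ
    νw≡1 = ι*recip n

    ℓz≡1 : ℓ * z ≡ 1ℚ
    ℓz≡1 = ι*recip L

    0≤w = 0≤recip n
    0≤z = 0≤recip L
    0≤ν = 0≤ι n
    0≤ℓ = 0≤ι L

    0≤b : 0ℚ ≤ b
    0≤b = 0≤-* (0≤x² w) (0≤-* (0≤x² ℓ) 0≤ℓ)

  open CompleteStart alg n K N₀ A b 0≤b

  -- Single products `Z` may be negative, but their total is a sum of squared codegrees.
  0≤Q : ∀ R → 0ℚ ≤ Q R
  0≤Q R = ≤-trans (0≤∑ V (λ v → 0≤∑ V (λ v′ → 0≤x² (codegree R v v′)))) (≤-reflexive (∑-codegree² R))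

  -- `disc≤` yields 4 disc ≤ 3A + bQ; since Q ≥ 0 there is room up to 4 (A + 5bQ).
  disc≤D : ∀ R σ τ → (∀ u → σ u * σ u ≤ 1ℚ) → (∀ v → τ v * τ v ≤ 1ℚ) → disc R σ τ ≤ D R
  disc≤D R σ τ σ²≤1 τ²≤1 = *-cancelˡ-≤-pos (ι 4) {{positive (0<ι 4)}} (begin
    ι 4 * disc R σ τ
      ≤⟨ disc≤ R σ τ σ²≤1 τ²≤1 (ν * z) (w * ℓ) (ν * (z * z)) (w * (ℓ * ℓ)) (0≤-* 0≤ν 0≤z) (0≤-* 0≤w 0≤ℓ) unit₁ (0≤-* 0≤ν (0≤x² z)) unit₂ ⟩
    ι 2 * (ν * (ν * z)) + w * ℓ * (ν * (ν * (ν * (z * z))) + w * (ℓ * ℓ) * Q R)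
      ≡⟨ regroup ν w ℓ z (Q R) ⟩
    ι 2 * (ν * ν * z) + ν * w * (ℓ * z) * (ν * ν * z) + b * Q R
      ≡⟨ cong₂ (λ x y → ι 2 * (ν * ν * z) + x * y * (ν * ν * z) + b * Q R) νw≡1 ℓz≡1 ⟩
    ι 2 * (ν * ν * z) + 1ℚ * 1ℚ * (ν * ν * z) + b * Q R
      ≤⟨ ≤-gap (ν * ν * z + ι 19 * (b * Q R)) (0≤-+ (0≤-* (0≤x² ν) 0≤z) (0≤-* (0≤ι 19) (0≤-* 0≤b (0≤Q R)))) (identity (ν * ν * z) b (Q R)) ⟩
    ι 4 * D R ∎)
    where
    open ≤-Reasoning
    pair : ∀ a b c d → a * d * (b * c) ≡ a * b * (c * d)
    pair = solve-∀ ℚ-ring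
    square : ∀ a b c d → a * (d * d) * (b * (c * c)) ≡ a * b * (c * d * (c * d))
    square = solve-∀ ℚ-ring
    unit₁ : ν * z * (w * ℓ) ≡ 1ℚ
    unit₁ = trans (pair ν w ℓ z) (cong₂ _*_ νw≡1 ℓz≡1)
    unit₂ : ν * (z * z) * (w * (ℓ * ℓ)) ≡ 1ℚ
    unit₂ = trans (square ν w ℓ z) (cong₂ _*_ νw≡1 (cong₂ _*_ ℓz≡1 ℓz≡1))
    regroup : ∀ ν w ℓ z q → ι 2 * (ν * (ν * z)) + w * ℓ * (ν * (ν * (ν * (z * z))) + w * (ℓ * ℓ) * q)
              ≡ ι 2 * (ν * ν * z) + ν * w * (ℓ * z) * (ν * ν * z) + w * w * (ℓ * ℓ * ℓ) * q
    regroup = solve-∀ ℚ-ring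
    identity : ∀ a b q → ι 2 * a + 1ℚ * 1ℚ * a + b * q + (a + ι 19 * (b * q)) ≡ ι 4 * (a + b * (ι 5 * q))
    identity = solve-∀ ℚ-ring

  -- From n = J³ M and L = J⁶ one gets n²/L = M², and N₀ = n M.
  ν⁴z≡N₀² : ν * ν * (ν * ν) * z ≡ ι N₀ * ι N₀
  ν⁴z≡N₀² = begin
    ν * ν * (ν * ν) * z
      ≡⟨ cong (λ x → ν * ν * (x * x) * z) (trans n≡ (cong (ι J *_) K≡)) ⟩
    ν * ν * (ι J * (ι J * ι J * ι M) * (ι J * (ι J * ι J * ι M))) * z
      ≡⟨ regroup ν (ι J) (ι M) z ⟩
    ν * ι M * (ν * ι M) * (ι J * ι J * ι J * (ι J * ι J * ι J) * z)
      ≡⟨ cong₂ (λ x y → x * x * (y * z)) (sym N₀≡) (sym L≡) ⟩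
    ι N₀ * ι N₀ * (ℓ * z)
      ≡⟨ trans (cong (ι N₀ * ι N₀ *_) ℓz≡1) (*-identityʳ _) ⟩
    ι N₀ * ι N₀ ∎
    where
    open ≡-Reasoning
    regroup : ∀ ν J M z → ν * ν * (J * (J * J * M) * (J * (J * J * M))) * z
                          ≡ ν * M * (ν * M) * (J * J * J * (J * J * J) * z)
    regroup = solve-∀ ℚ-ring

  -- The choice n = 70 L⁴ balances the two terms: 70 L³ n³ = n⁴/L, the same as A n².
  AN+bPot≤ : A * ι (length all) + b * Pot all ≤ ι 2 * (ι N₀ * ι N₀)
  AN+bPot≤ = begin
    A * ι (length all) + b * Pot all
      ≤⟨ +-mono-≤ (≤-reflexive (cong (A *_) ι-length-all)) (*-monoˡ 0≤b Pot-all) ⟩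
    A * N + b * (ι 70 * (N * N * ν))
      ≡⟨ regroup ν w ℓ z ⟩
    ν * ν * (ν * ν) * z + ι 70 * (ℓ * ℓ * ℓ) * (ν * w * (ν * w)) * (ν * ν * ν)
      ≡⟨ cong₂ (λ x y → ν * ν * (ν * ν) * z + ι 70 * (ℓ * ℓ * ℓ) * (x * y) * (ν * ν * ν)) νw≡1 (trans νw≡1 (sym ℓz≡1)) ⟩
    ν * ν * (ν * ν) * z + ι 70 * (ℓ * ℓ * ℓ) * (1ℚ * (ℓ * z)) * (ν * ν * ν)
      ≡⟨ collect ν ℓ z ⟩
    (ν + ι 70 * (ℓ * ℓ * (ℓ * ℓ))) * (ν * ν * ν * z)
      ≡⟨ cong (λ x → (ν + x) * (ν * ν * ν * z)) (sym n≡70L⁴) ⟩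
    (ν + ν) * (ν * ν * ν * z)
      ≡⟨ double ν z ⟩
    ι 2 * (ν * ν * (ν * ν) * z)
      ≡⟨ cong (ι 2 *_) ν⁴z≡N₀² ⟩
    ι 2 * (ι N₀ * ι N₀) ∎
    where
    open ≤-Reasoning
    regroup : ∀ ν w ℓ z → ν * ν * z * (ν * ν) + w * w * (ℓ * ℓ * ℓ) * (ι 70 * (ν * ν * (ν * ν) * ν))
              ≡ ν * ν * (ν * ν) * z + ι 70 * (ℓ * ℓ * ℓ) * (ν * w * (ν * w)) * (ν * ν * ν)
    regroup = solve-∀ ℚ-ring
    collect : ∀ ν ℓ z → ν * ν * (ν * ν) * z + ι 70 * (ℓ * ℓ * ℓ) * (1ℚ * (ℓ * z)) * (ν * ν * ν)
              ≡ (ν + ι 70 * (ℓ * ℓ * (ℓ * ℓ))) * (ν * ν * ν * z)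
    collect = solve-∀ ℚ-ring
    double : ∀ ν z → (ν + ν) * (ν * ν * ν * z) ≡ ι 2 * (ν * ν * (ν * ν) * z)
    double = solve-∀ ℚ-ring

  -- N₀/K² = J M/K by n = J K, and K = J² M.
  gN₀≡1/J : g * ι N₀ ≡ recip J
  gN₀≡1/J = begin
    g * ι N₀
      ≡⟨ cong (g *_) (trans N₀≡ (cong (_* ι M) n≡)) ⟩
    κ * κ * (ι J * ι K * ι M)
      ≡⟨ sym (trans (cong (κ * κ * (ι J * ι K * ι M) *_) (ι*recip J)) (*-identityʳ _)) ⟩
    κ * κ * (ι J * ι K * ι M) * (ι J * ε)
      ≡⟨ regroup κ (ι J) (ι K) (ι M) ε ⟩
    ι K * κ * (ι J * ι J * ι M * κ) * ε
      ≡⟨ cong₂ (λ x y → x * (y * κ) * ε) (ι*recip K) (sym K≡) ⟩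
    1ℚ * (ι K * κ) * ε
      ≡⟨ cong (λ x → 1ℚ * x * ε) (ι*recip K) ⟩
    1ℚ * 1ℚ * ε
      ≡⟨ *-identityˡ ε ⟩
    ε ∎
    where
    open ≡-Reasoning
    κ = recip K
    ε = recip J
    regroup : ∀ κ J K M ε → κ * κ * (J * K * M) * (J * ε) ≡ K * κ * (J * J * M * κ) * ε
    regroup = solve-∀ ℚ-ring

  -- The 1 is the evenly spread part, n² edges at 1/n² each. The discrepancy adds 2 g N₀ and the
  -- last N₀ edges add g N₀.
  energy-all≤ : energy all ≤ 1ℚ + ι 3 * recip J
  energy-all≤ = begin
    energy all
      ≤⟨ +-mono-≤ (≤-reflexive (trans (*-comm d (ι (length all))) ι*d≡1))
           (*-monoˡ (0≤x² (recip K)) (+-mono-≤ (*-monoˡ (0≤recip N₀) AN+bPot≤) (ι-mono (ℕₚ.m⊓n≤n (length all) N₀)))) ⟩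
    1ℚ + g * (θ * (ι 2 * (ι N₀ * ι N₀)) + ι N₀)
      ≡⟨ regroup g θ (ι N₀) ⟩
    1ℚ + (ι 2 * (ι N₀ * θ) + 1ℚ) * (g * ι N₀)
      ≡⟨ cong₂ (λ x y → 1ℚ + (ι 2 * x + 1ℚ) * y) (ι*recip N₀) gN₀≡1/J ⟩
    1ℚ + ι 3 * recip J ∎
    where
    open ≤-Reasoning
    regroup : ∀ g θ N → 1ℚ + g * (θ * (ι 2 * (N * N)) + N) ≡ 1ℚ + (ι 2 * (N * θ) + 1ℚ) * (g * N)
    regroup = solve-∀ ℚ-ring

  c₀ Y : ℚ
  c₀ = ι K
  Y  = (½ * ν) * (½ * ν)

  -- For y = s + K this is AM-GM, n ≤ y + n²/(4y), with equality at y = n/2; the gap is (y -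
  -- n/2)²/y.
  tangent : ∀ s → ν - ι s ≤ c₀ + Y * recip (s +ᴺ K)
  tangent s = ≤-gap (x * ((y - ½ * ν) * (y - ½ * ν))) (0≤-* (0≤recip (s +ᴺ K)) (0≤x² (y - ½ * ν))) (begin
    ν - ι s + x * ((y - ½ * ν) * (y - ½ * ν))
      ≡⟨ expand ν (ι s) x y ⟩
    ν - ι s + (y * x * (y - ν) + Y * x)
      ≡⟨ cong₂ (λ t y → ν - ι s + (t * (y - ν) + Y * x)) (ι*recip (s +ᴺ K) {{s+K≢0 K s}}) (ι-+ s K) ⟩
    ν - ι s + (1ℚ * (ι s + ι K - ν) + Y * x)
      ≡⟨ cancel ν (ι s) (ι K) (Y * x) ⟩
    c₀ + Y * x ∎)
    where
    open ≡-Reasoning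
    x = recip (s +ᴺ K)
    y = ι (s +ᴺ K)
    expand : ∀ ν s x y → ν - s + x * ((y - ½ * ν) * (y - ½ * ν)) ≡ ν - s + (y * x * (y - ν) + (½ * ν) * (½ * ν) * x)
    expand = solve-∀ ℚ-ring
    cancel : ∀ ν s K t → ν - s + (1ℚ * (s + K - ν) + t) ≡ K + t
    cancel = solve-∀ ℚ-ring

  open Supersolution c₀ Y (0≤x² (½ * ν)) tangent disc≤D using (Ψ; total≤)

  -- The tangent costs K = n/J, and n²/4 times 2/n + 3/(n J) is n/2 + 3n/(4J); the total of 7/4 in
  -- front of n/J is rounded up to 2.
  Ψ-start≤ : Ψ n all ≤ (½ + ι 2 * recip J) * ν
  Ψ-start≤ = begin
    c₀ + Y * (recip (n +ᴺ K) + w * energy all)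
      ≤⟨ +-monoʳ-≤ c₀ (*-monoˡ (0≤x² (½ * ν)) (+-mono-≤ (recip-antimono (ℕₚ.m≤m+n n K)) (*-monoˡ 0≤w energy-all≤))) ⟩
    ι K + Y * (w + w * (1ℚ + ι 3 * ε))
      ≡⟨ cong₂ _+_ K≡νε (regroup ν w ε) ⟩
    ν * ε + ν * w * (½ * ν + ½ * ½ * ι 3 * ν * ε)
      ≡⟨ cong (λ x → ν * ε + x * (½ * ν + ½ * ½ * ι 3 * ν * ε)) νw≡1 ⟩
    ν * ε + 1ℚ * (½ * ν + ½ * ½ * ι 3 * ν * ε)
      ≤⟨ ≤-gap (½ * ½ * ν * ε) (0≤-* (0≤-* (toWitness {a? = 0ℚ ≤? ½ * ½} _) 0≤ν) (0≤recip J)) (identity ν ε) ⟩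
    (½ + ι 2 * ε) * ν ∎
    where
    open ≤-Reasoning
    ε = recip J
    swap : ∀ J K ε → K * (J * ε) ≡ J * K * ε
    swap = solve-∀ ℚ-ring
    K≡νε : ι K ≡ ν * ε
    K≡νε = trans (sym (trans (cong (ι K *_) (ι*recip J)) (*-identityʳ (ι K))))
      (trans (swap (ι J) (ι K) ε) (cong (_* ε) (sym n≡)))
    regroup : ∀ ν w ε → (½ * ν) * (½ * ν) * (w + w * (1ℚ + ι 3 * ε)) ≡ ν * w * (½ * ν + ½ * ½ * ι 3 * ν * ε)
    regroup = solve-∀ ℚ-ring
    identity : ∀ ν ε → ν * ε + 1ℚ * (½ * ν + ½ * ½ * ι 3 * ν * ε) + ½ * ½ * ν * ε ≡ (½ + ι 2 * ε) * ν
    identity = solve-∀ ℚ-ring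

  c≤½+2/J : ∀ c → SelectableOnBipartite alg c → c ≤ ½ + ι 2 * recip J
  c≤½+2/J c selectable = *-cancelʳ-≤-pos ν {{positive (0<ι n)}} (≤-trans cν≤Ψ Ψ-start≤)
    where
    m! = ι ((n *ᴺ n) !ᴺ)
    0<m! : 0ℚ < m!
    0<m! = 0<ι ((n *ᴺ n) !ᴺ) {{ (n *ᴺ n) ℕₚ.!≢0 }}
    cν≤Ψ : c * ν ≤ Ψ n all
    cν≤Ψ = *-cancelʳ-≤-pos m! {{positive 0<m!}} (≤-trans (selectable⇒ c selectable)
      (≤-trans (total≤ (n *ᴺ n) all length-all Simple-all start) (≤-reflexive (*-comm m! (Ψ n all)))))

-- Letting J grow.

c≤½+2/j : ∀ alg c → SelectableOnBipartite alg c → ∀ j → .{{ℕ.NonZero j}} → c ≤ ½ + ι 2 * recip j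
c≤½+2/j alg c selectable j {{j≢0}} = Parameters.c≤½+2/J alg j L M K n N₀
  {{L≢0 = L≢0}} {{K≢0}} {{n≢0}} {{N₀≢0}} L≡ K≡ n≡ (ι-* n M) n≡70L⁴ c selectable
  where
  J³ L M K n N₀ : ℕ
  J³ = j *ᴺ j *ᴺ j
  L  = J³ *ᴺ J³
  -- Chosen so that n = J³ M = 70 J⁶ L³ = 70 L⁴ holds in the natural numbers, without division.
  M  = 70 *ᴺ (J³ *ᴺ (L *ᴺ L *ᴺ L))
  K  = j *ᴺ j *ᴺ M
  n  = j *ᴺ K
  N₀ = n *ᴺ M
  J³≢0 : ℕ.NonZero J³
  J³≢0 = ℕₚ.m*n≢0 (j *ᴺ j) j {{ℕₚ.m*n≢0 j j}}
  L≢0 : ℕ.NonZero L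
  L≢0 = ℕₚ.m*n≢0 J³ J³ {{J³≢0}} {{J³≢0}}
  M≢0 : ℕ.NonZero M
  M≢0 = ℕₚ.m*n≢0 70 (J³ *ᴺ (L *ᴺ L *ᴺ L)) {{_}} {{ℕₚ.m*n≢0 J³ (L *ᴺ L *ᴺ L) {{J³≢0}} {{ℕₚ.m*n≢0 (L *ᴺ L) L {{ℕₚ.m*n≢0 L L {{L≢0}} {{L≢0}}}} {{L≢0}}}}}}
  K≢0 : ℕ.NonZero K
  K≢0 = ℕₚ.m*n≢0 (j *ᴺ j) M {{ℕₚ.m*n≢0 j j}} {{M≢0}}
  n≢0 : ℕ.NonZero n
  n≢0 = ℕₚ.m*n≢0 j K {{j≢0}} {{K≢0}}
  N₀≢0 : ℕ.NonZero N₀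
  N₀≢0 = ℕₚ.m*n≢0 n M {{n≢0}} {{M≢0}}
  J³≡ : ι J³ ≡ ι j * ι j * ι j
  J³≡ = trans (ι-* (j *ᴺ j) j) (cong (_* ι j) (ι-* j j))
  L≡ : ι L ≡ ι j * ι j * ι j * (ι j * ι j * ι j)
  L≡ = trans (ι-* J³ J³) (cong₂ _*_ J³≡ J³≡)
  K≡ : ι K ≡ ι j * ι j * ι M
  K≡ = trans (ι-* (j *ᴺ j) M) (cong (_* ι M) (ι-* j j))
  n≡ : ι n ≡ ι j * ι K
  n≡ = ι-* j K
  n≡70L⁴ : ι n ≡ ι 70 * (ι L * ι L * (ι L * ι L))
  n≡70L⁴ = begin
    ι n
      ≡⟨ trans n≡ (cong (ι j *_) K≡) ⟩
    ι j * (ι j * ι j * ι M)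
      ≡⟨ cong (λ x → ι j * (ι j * ι j * x)) (trans (ι-* 70 (J³ *ᴺ (L *ᴺ L *ᴺ L))) (cong (ι 70 *_)
           (trans (ι-* J³ (L *ᴺ L *ᴺ L)) (cong₂ _*_ J³≡ (trans (ι-* (L *ᴺ L) L) (cong (_* ι L) (ι-* L L))))))) ⟩
    ι j * (ι j * ι j * (ι 70 * (ι j * ι j * ι j * (ι L * ι L * ι L))))
      ≡⟨ regroup (ι j) (ι L) ⟩
    ι 70 * (ι j * ι j * ι j * (ι j * ι j * ι j) * ι L * (ι L * ι L))
      ≡⟨ cong (λ x → ι 70 * (x * ι L * (ι L * ι L))) (sym L≡) ⟩
    ι 70 * (ι L * ι L * (ι L * ι L)) ∎
    where
    open ≡-Reasoning
    regroup : ∀ j L → j * (j * j * (ι 70 * (j * j * j * (L * L * L)))) ≡ ι 70 * (j * j * j * (j * j * j) * L * (L * L))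
    regroup = solve-∀ ℚ-ring

theorem5 : (R : RCRS) (c : ℚ) → SelectableOnBipartite R c → c ≤ ½
theorem5 R c selectable = ≮⇒≥ impossible
  where
  impossible : ¬ ½ < c
  impossible ½<c = <-irrefl refl (begin-strict
    ι 2                             <⟨ ≤-gap-strict ⟩
    ι 3 * 1ℚ                        ≤⟨ *-monoˡ (0≤ι 3) (1≤denominator* δ 0<δ) ⟩
    ι 3 * (ι q * δ)                 ≡⟨ assoc (ι q) δ ⟩
    ι 3 * ι q * δ                   ≡⟨ cong (_* δ) (sym (ι-* 3 q)) ⟩
    ι j * δ                         ≤⟨ *-monoˡ (0≤ι j) δ≤ ⟩
    ι j * (ι 2 * recip j)           ≡⟨ comm (ι j) (recip j) ⟩
    ι 2 * (ι j * recip j)           ≡⟨ cong (ι 2 *_) (ι*recip j {{j≢0}}) ⟩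
    ι 2 * 1ℚ                        ≡⟨ *-identityʳ (ι 2) ⟩
    ι 2                             ∎)
    where
    open ≤-Reasoning
    δ = c - ½
    0<δ : 0ℚ < δ
    0<δ = ≤-<-trans (≤-reflexive (sym (+-inverseʳ ½))) (+-monoˡ-< (- ½) ½<c)
    q = ↧ₙ δ
    -- As q is the denominator of δ, q δ ≥ 1 and so j δ ≥ 3, whereas the bound at j gives j δ ≤ 2.
    j = 3 *ᴺ q
    j≢0 : ℕ.NonZero j
    j≢0 = ℕₚ.m*n≢0 3 q
    ≤-gap-strict : ι 2 < ι 3 * 1ℚ
    ≤-gap-strict = toWitness {a? = ι 2 <? ι 3 * 1ℚ} _
    assoc : ∀ q δ → ι 3 * (q * δ) ≡ ι 3 * q * δ
    assoc = solve-∀ ℚ-ring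
    comm : ∀ j r → j * (ι 2 * r) ≡ ι 2 * (j * r)
    comm = solve-∀ ℚ-ring
    cancel : ∀ x → ½ + x - ½ ≡ x
    cancel = solve-∀ ℚ-ring
    δ≤ : δ ≤ ι 2 * recip j
    δ≤ = ≤-trans (+-monoˡ-≤ (- ½) (c≤½+2/j R c selectable j {{j≢0}})) (≤-reflexive (cancel (ι 2 * recip j)))
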